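{- Let $m,N\in\mathbb{N}$. Then the number $\mathcal{N}_m(N)$ of $m$-part sum systems $(A_1,\dots,A_m)$ generating the integers $0,1,\dots,N-1$, with $|A_j|\ge 2$ for every $j$ (equivalently, the number of $m$-part centred sum systems), is \[ \mathcal{N}_m(N)=\sum_{L=0}^\infty m!\,S(L,m)\,(e-\mu)^{*L}(N)=\sum_{L=0}^\infty m!\,S(L,m)\,c_L^{(-L)}(N), \] where $S(L,m)$ are the Stirling numbers of the second kind.
   Context: An $m$-part sum system generating $0,\dots,N-1$ is an ordered $m$-tuple of sets $A_1,\dots,A_m\subset\mathbb{N}_0$ with $|A_1|\cdots|A_m|=N$ and $A_1+\dots+A_m=\{0,1,\dots,N-1\}$ (Minkowski sum). Arithmetic functions are combined by Dirichlet convolution $(f*g)(n)=\sum_{ab=n}f(a)g(b)$; $f^{*L}$ is the $L$-fold convolution power with $f^{*0}=e$, where $e(n)=\delta_{n,1}$; $1$ denotes the constant function $1$ and $\mu$ the Möbius function. The associated divisor function is $c_L^{(-L)}=(1-e)^{*L}*\mu^{*L}$ (which equals $(e-\mu)^{*L}$). The sums are finite since the terms vanish for large $L$. -}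

module Defs where

open import Data.Nat as ℕ using (ℕ; zero; suc; _≤_; _<_; _!; _∸_)
open import Data.Nat.Divisibility using (_∣_; _∣?_)
open import Data.Nat.DivMod using (_/_)
open import Data.Nat.Primality using (prime?)
open import Data.Integer as ℤ using (ℤ; +_; -_; _-_)
open import Data.Fin using (Fin; toℕ)
open import Data.Fin.Subset using (Subset; _∈_; ∣_∣)
open import Data.Vec using (Vec; lookup; map)
import Data.Vec as Vec
open import Data.List as List using (List; upTo; filter; length)
open import Data.List.Relation.Unary.Unique.Propositional using (Unique)
import Data.List.Membership.Propositional as LM
open import Data.List.Relation.Unary.All using (All)
open import Data.Product using (Σ; ∃; _×_)
import Data.Bool
open import Data.Bool using (Bool; true; false; if_then_else_; not)
open import Relation.Nullary using (does)
open import Relation.Binary.PropositionalEquality using (_≡_)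
open import Function.Bundles using (_⇔_)

NumberOf : {A : Set} → (A → Set) → ℕ → Set
NumberOf {A} P k =
  Σ (List A) λ xs → Unique xs × (length xs ≡ k) × (∀ x → (x LM.∈ xs) ⇔ P x)

-- Sum systems.  A set A_j ⊂ ℕ₀ is represented as a subset of
-- {0,…,N-1} (Subset N).

productℕ : ∀ {m} → Vec ℕ m → ℕ
productℕ = Vec.foldr _ ℕ._*_ 1

InSumset : ∀ {m N} → Vec (Subset N) m → ℕ → Set
InSumset {m} {N} A n =
  Σ (Vec (Fin N) m) λ a →
    (∀ j → lookup a j ∈ lookup A j) × (Vec.sum (map toℕ a) ≡ n)

IsSumSystem : (m N : ℕ) → Vec (Subset N) m → Set
IsSumSystem m N A =
  (productℕ (map ∣_∣ A) ≡ N) × (∀ n → InSumset A n ⇔ (n < N))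

IsProperSumSystem : (m N : ℕ) → Vec (Subset N) m → Set
IsProperSumSystem m N A = IsSumSystem m N A × (∀ j → 2 ≤ ∣ lookup A j ∣)

S : ℕ → ℕ → ℕ
S zero    zero    = 1
S zero    (suc k) = 0
S (suc n) zero    = 0
S (suc n) (suc k) = suc k ℕ.* S n (suc k) ℕ.+ S n k

-- Arithmetic functions (values at 0 are irrelevant)

ArithFun : Set
ArithFun = ℕ → ℤ

sumℤ : List ℤ → ℤ
sumℤ = List.foldr ℤ._+_ (+ 0)

_⋆_ : ArithFun → ArithFun → ArithFun
(f ⋆ g) n = sumℤ (List.map term (upTo n))
  where
  term : ℕ → ℤ
  term k = if does (suc k ∣? n) then f (suc k) ℤ.* g (n / suc k) else + 0

e : ArithFun
e n = if does (n ℕ.≟ 1) then + 1 else + 0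

one : ArithFun
one n = + 1

_⊖_ : ArithFun → ArithFun → ArithFun
(f ⊖ g) n = f n - g n

squarefree : ℕ → Bool
squarefree n = List.foldr Data.Bool._∧_ true
  (List.map (λ k → not (does ((suc (suc k)) ℕ.* (suc (suc k)) ∣? n))) (upTo n))

ω : ℕ → ℕ
ω n = length (filter (λ p → prime? p Relation.Nullary.×-dec (p ∣? n)) (upTo (suc n)))

μ : ArithFun
μ n = if squarefree n then (- (+ 1)) ℤ.^ ω n else + 0

_^⋆_ : ArithFun → ℕ → ArithFun
f ^⋆ zero  = e
f ^⋆ suc L = f ⋆ (f ^⋆ L)

c : ℕ → ArithFun
c L = ((one ⊖ e) ^⋆ L) ⋆ (μ ^⋆ L)

sumBelow : (ℕ → ℤ) → ℕ → ℤ
sumBelow a zero    = + 0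
sumBelow a (suc K) = sumBelow a K ℤ.+ a K

FiniteSeriesSum : (ℕ → ℤ) → ℤ → Set
FiniteSeriesSum a s = ∃ λ K → (∀ L → K ≤ L → a L ≡ + 0) × (sumBelow a K ≡ s)

{-# OPTIONS --safe #-}
module Submission where

-- For N ≥ 2 exactly one part A_j of a sum system for {0,…,N−1} contains 1.  If d is the least non-element of A_j, then
-- (de Bruijn) d divides N and A_j = {0,…,d−1} + d A′_j, A_i = d A′_i for i ≠ j, where A′ is a sum system for
-- {0,…,N/d−1} with 1 ∉ A′_j, and all such pairs (d, A′) occur.  Let P_m count the systems with m nontrivial parts and
-- let b_m count those among them with 1 ∈ A_j, for a fixed j.  In A′ only the part A′_j may be {0}, so
-- b_m = (1 − e) ⋆ (P_m + P_{m−1} − b_m).  Since 1 ⋆ μ = e, this gives b_m = (e − μ) ⋆ (P_m + P_{m−1}), whence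
-- P_m = m b_m; the numbers Σ_L m! S(L,m) (e − μ)^{⋆L} satisfy the same recursion because
-- m! S(L+1,m) = m (m! S(L,m) + (m−1)! S(L,m−1)).

open import Defs
open import Data.Bool as Bool using (Bool; true; false; if_then_else_; _∧_; not)
open import Data.Fin as Fin using (Fin; zero; suc; toℕ; fromℕ<; punchIn; punchOut)
open import Data.Fin.Properties using (toℕ-fromℕ<; punchInᵢ≢i; punchIn-punchOut)
open import Data.Fin.Subset using (Subset; _∈_; ∣_∣)
open import Data.Integer as ℤ using (ℤ; 0ℤ)
import Data.Integer.Properties as ℤₚ
open import Data.Integer.Tactic.RingSolver using (solve-∀)
open import Data.List as List using (List; []; _∷_; _++_; length; filter; upTo; applyUpTo; cartesianProductWith)
open import Data.List.Membership.Propositional using () renaming (_∈_ to _∈ˡ_)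
open import Data.List.Membership.Propositional.Properties
  using (∈-++⁺ˡ; ∈-++⁺ʳ; ∈-++⁻; ∈-∃++; ∈-map⁺; ∈-map⁻; ∈-filter⁺; ∈-filter⁻; ∈-upTo⁺; ∈-upTo⁻;
         ∈-cartesianProductWith⁺; ∈-cartesianProductWith⁻)
open import Data.List.Properties using (length-map; length-++; length-++-sucʳ; length-upTo; map-applyUpTo)
open import Data.List.Relation.Unary.All as All using ([]; _∷_)
open import Data.List.Relation.Unary.AllPairs using ([]; _∷_)
open import Data.List.Relation.Unary.Any using (here; there)
open import Data.List.Relation.Unary.Unique.Propositional using (Unique)
import Data.List.Relation.Unary.Unique.Propositional.Properties as Unique
open import Data.Nat as ℕ using (zero; suc; _<_; z≤n; s≤s; NonZero)
open import Data.Nat.Coprimality using (Coprime; coprime-divisor)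
open import Data.Nat.Divisibility
open import Data.Nat.DivMod
open import Data.Nat.Induction using (<-rec)
open import Data.Nat.Primality
  using (Prime; prime?; euclidsLemma; prime⇒irreducible; prime⇒nonZero; ¬prime[0]; ¬prime[1])
open import Data.Nat.Primality.Factorisation using (factorise)
open import Data.Nat.Properties as ℕₚ
  using (≤-trans; ≤-refl; ≤-reflexive; <⇒≤; +-comm; +-assoc; +-identityʳ; *-distribʳ-+)
open import Data.Nat.Tactic.RingSolver using () renaming (solve-∀ to ℕ-solve-∀)
open import Data.Product using (_,_; proj₁; proj₂)
open import Data.Sum using (_⊎_; inj₁; inj₂; [_,_]′)
open import Data.Vec as Vec using (Vec; []; _∷_; lookup; tabulate)
open import Data.Vec.Functional using (insertAt)
open import Data.Vec.Functional.Properties using ()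
  renaming (insertAt-lookup to insertAt-at; insertAt-punchIn to insertAt-off)
open import Data.Vec.Properties
  using (lookup∘tabulate; ≡-dec; []=⇒lookup; lookup⇒[]=; ∷-injective; insertAt-lookup; insertAt-punchIn)
open import Algebra.Properties.CommutativeMonoid.Sum ℕₚ.+-0-commutativeMonoid
  using (sum; sum-remove; sum-cong-≗; sum-replicate-zero)
open import Algebra.Properties.Semiring.Sum ℕₚ.+-*-semiring using (*-distribʳ-sum)
open import Function using (_∘_; id)
open import Function.Bundles using (_⇔_; Equivalence; mk⇔)
open import Relation.Binary.PropositionalEquality hiding (_≡_)
open import Relation.Nullary using (Dec; does; yes; no; ¬_; contradiction; ¬?; _×-dec_; _→-dec_)
open import Relation.Nullary.Decidable using (dec-true; dec-false)

open import Data.Nat using (ℕ; _≤_; _!)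
open import Data.Product using (∃; _×_)
open import Relation.Binary.PropositionalEquality using (_≡_)

-- Taking d to be the least missing element makes the pair (d, A′) unique, at the price of the
-- restriction 1 ∉ A′_j; this is why b_m occurs on both sides of its recursion. Moving (1 - e) ⋆ b_m
-- to the left turns it into 1 ⋆ b_m = (1 - e) ⋆ (P_m + P_{m-1}), and multiplication by μ produces
-- the factor (1 - e) ⋆ μ = e - μ. The formal argument goes the opposite way: the closed formula is
-- checked against the recursion, which determines the counts by strong induction on N, since 1 - e
-- vanishes at 1 and so only arguments N/d < N enter. The definition of a sum system prescribes the
-- product of the cardinalities, whereas the decomposition needs every n < N to have exactly one
-- representation; a pigeonhole argument on the list of all choices of summands translates between
-- the two. De Bruijn's argument itself concerns two summands only, A_j and the sumset C of the
-- other parts.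

/≥1 : ∀ {n} k → 1 ≤ n → suc k ∣ n → 1 ≤ n / suc k
/≥1 k 1≤n d = ℕₚ.n≢0⇒n>0 λ eq → ℕₚ.<⇒≢ 1≤n (trans (sym (cong (ℕ._* suc k) eq)) (m/n*n≡m d))

-- Finite sums of integers.

module DirichletAlgebra where

  open import Data.Integer using (+_; -_; _-_; _+_; _*_)

  sumBelow-cong : ∀ {f g : ℕ → ℤ} K → (∀ i → i < K → f i ≡ g i) → sumBelow f K ≡ sumBelow g K
  sumBelow-cong zero    eq = refl
  sumBelow-cong (suc K) eq =
    cong₂ _+_ (sumBelow-cong K (λ i i<K → eq i (ℕₚ.m<n⇒m<1+n i<K))) (eq K ℕₚ.≤-refl)

  sumBelow-zero : ∀ {f : ℕ → ℤ} K → (∀ i → i < K → f i ≡ 0ℤ) → sumBelow f K ≡ 0ℤ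
  sumBelow-zero zero    eq = refl
  sumBelow-zero (suc K) eq =
    cong₂ _+_ (sumBelow-zero K (λ i i<K → eq i (ℕₚ.m<n⇒m<1+n i<K))) (eq K ℕₚ.≤-refl)

  +-interchange : ∀ a b c d → (a + b) + (c + d) ≡ (a + c) + (b + d)
  +-interchange = solve-∀

  sumBelow-+ : ∀ (f g : ℕ → ℤ) K → sumBelow (λ i → f i + g i) K ≡ sumBelow f K + sumBelow g K
  sumBelow-+ f g zero    = refl
  sumBelow-+ f g (suc K) =
    trans (cong (_+ (f K + g K)) (sumBelow-+ f g K)) (+-interchange (sumBelow f K) (sumBelow g K) (f K) (g K))

  sumBelow-*ˡ : ∀ c (f : ℕ → ℤ) K → c * sumBelow f K ≡ sumBelow (λ i → c * f i) K
  sumBelow-*ˡ c f zero    = ℤₚ.*-zeroʳ c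
  sumBelow-*ˡ c f (suc K) =
    trans (ℤₚ.*-distribˡ-+ c (sumBelow f K) (f K)) (cong (_+ c * f K) (sumBelow-*ˡ c f K))

  sumBelow-*ʳ : ∀ c (f : ℕ → ℤ) K → sumBelow f K * c ≡ sumBelow (λ i → f i * c) K
  sumBelow-*ʳ c f zero    = refl
  sumBelow-*ʳ c f (suc K) =
    trans (ℤₚ.*-distribʳ-+ c (sumBelow f K) (f K)) (cong (_+ f K * c) (sumBelow-*ʳ c f K))

  sumBelow-swap : ∀ (f : ℕ → ℕ → ℤ) K L →
    sumBelow (λ i → sumBelow (f i) L) K ≡ sumBelow (λ j → sumBelow (λ i → f i j) K) L
  sumBelow-swap f zero    L = sym (sumBelow-zero L (λ _ _ → refl))
  sumBelow-swap f (suc K) L =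
    trans (cong (_+ sumBelow (f K) L) (sumBelow-swap f K L))
          (sym (sumBelow-+ (λ j → sumBelow (λ i → f i j) K) (f K) L))

  sumBelow-extend : ∀ {f : ℕ → ℤ} {K M} → K ≤ M → (∀ i → K ≤ i → f i ≡ 0ℤ) → sumBelow f M ≡ sumBelow f K
  sumBelow-extend {f} {K} {M} K≤M vanish = go (ℕₚ.≤⇒≤′ K≤M)
    where
    go : ∀ {M} → K ℕ.≤′ M → sumBelow f M ≡ sumBelow f K
    go ℕ.≤′-refl        = refl
    go (ℕ.≤′-step K≤M) =
      trans (cong₂ _+_ (go K≤M) (vanish _ (ℕₚ.≤′⇒≤ K≤M))) (ℤₚ.+-identityʳ _)

  sumBelow-single : ∀ {f : ℕ → ℤ} {k K} → k < K → (∀ i → i < K → i ≢ k → f i ≡ 0ℤ) → sumBelow f K ≡ f k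
  sumBelow-single {f} {k} {suc K} k<K vanish with K ℕ.≟ k
  ... | yes refl = trans
    (cong (_+ f K) (sumBelow-zero K (λ i i<K → vanish i (ℕₚ.m<n⇒m<1+n i<K) (ℕₚ.<⇒≢ i<K))))
    (ℤₚ.+-identityˡ (f K))
  ... | no K≢k = trans
    (cong₂ _+_ (sumBelow-single (ℕₚ.≤∧≢⇒< (ℕₚ.≤-pred k<K) (K≢k ∘ sym))
                 (λ i i<K → vanish i (ℕₚ.m<n⇒m<1+n i<K)))
               (vanish K ℕₚ.≤-refl K≢k))
    (ℤₚ.+-identityʳ (f k))

  sumBelow-suc : ∀ (f : ℕ → ℤ) K → sumBelow f (suc K) ≡ f 0 + sumBelow (f ∘ suc) K
  sumBelow-suc f zero    = ℤₚ.+-comm 0ℤ (f 0)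
  sumBelow-suc f (suc K) =
    trans (cong (_+ f (suc K)) (sumBelow-suc f K)) (ℤₚ.+-assoc (f 0) (sumBelow (f ∘ suc) K) (f (suc K)))

  sumℤ-applyUpTo : ∀ (f : ℕ → ℤ) K → sumℤ (applyUpTo f K) ≡ sumBelow f K
  sumℤ-applyUpTo f zero    = refl
  sumℤ-applyUpTo f (suc K) =
    trans (cong (_+_ (f 0)) (sumℤ-applyUpTo (f ∘ suc) K)) (sym (sumBelow-suc f K))

  sumℤ-map-upTo : ∀ (f : ℕ → ℤ) K → sumℤ (List.map f (upTo K)) ≡ sumBelow f K
  sumℤ-map-upTo f K = trans (cong sumℤ (map-applyUpTo id f K)) (sumℤ-applyUpTo f K)

  -- Branching on `does` reproduces the conditional in the definition of `_⋆_`, so that the terms of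
  -- a convolution have this form by computation.
  when : {P : Set} → Dec P → ℤ → ℤ
  when P? z = if does P? then z else 0ℤ

  when-yes : ∀ {P : Set} (P? : Dec P) z → P → when P? z ≡ z
  when-yes P? z p rewrite dec-true P? p = refl

  when-no : ∀ {P : Set} (P? : Dec P) z → ¬ P → when P? z ≡ 0ℤ
  when-no P? z ¬p rewrite dec-false P? ¬p = refl

  when-⇔ : ∀ {P Q : Set} (P? : Dec P) (Q? : Dec Q) z → (P → Q) → (Q → P) → when P? z ≡ when Q? z
  when-⇔ P? (yes q) z f g = when-yes P? z (g q)
  when-⇔ P? (no ¬q) z f g = when-no P? z (¬q ∘ f)

  when-0 : ∀ {P : Set} (P? : Dec P) → when P? 0ℤ ≡ 0ℤ
  when-0 (yes _) = refl
  when-0 (no _) = refl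

  when-*ˡ : ∀ {P : Set} (P? : Dec P) c z → c * when P? z ≡ when P? (c * z)
  when-*ˡ (yes _) c z = refl
  when-*ˡ (no _)  c z = ℤₚ.*-zeroʳ c

  when-cong : ∀ {P : Set} (P? : Dec P) {y z} → (P → y ≡ z) → when P? y ≡ when P? z
  when-cong (yes p) eq = eq p
  when-cong (no _)  eq = refl

  when-+ : ∀ {P : Set} (P? : Dec P) y z → when P? (y + z) ≡ when P? y + when P? z
  when-+ (yes _) y z = refl
  when-+ (no _)  y z = refl

  when-sumBelow : ∀ {P : Set} (P? : Dec P) f K → when P? (sumBelow f K) ≡ sumBelow (λ i → when P? (f i)) K
  when-sumBelow (yes _) f K = refl
  when-sumBelow (no _)  f K = sym (sumBelow-zero K (λ _ _ → refl))

  -- Dirichlet convolution as a commutative and associative product.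

  ⋆-term : ArithFun → ArithFun → ℕ → ℕ → ℤ
  ⋆-term f g n k = when (suc k ∣? n) (f (suc k) * g (n / suc k))

  ⋆-as-sumBelow : ∀ f g n → (f ⋆ g) n ≡ sumBelow (⋆-term f g n) n
  ⋆-as-sumBelow f g n = sumℤ-map-upTo _ n

  -- Junk values at 0 make equality of arithmetic functions meaningful only on positive arguments.
  infix 4 _≗⁺_
  _≗⁺_ : ArithFun → ArithFun → Set
  f ≗⁺ g = ∀ n → 1 ≤ n → f n ≡ g n

  ⋆-term-cong : ∀ {f f′ g g′} n k → 1 ≤ n → f (suc k) ≡ f′ (suc k) →
    (suc k ∣ n → g (n / suc k) ≡ g′ (n / suc k)) → ⋆-term f g n k ≡ ⋆-term f′ g′ n k
  ⋆-term-cong n k 1≤n feq geq = when-cong (suc k ∣? n) (λ d → cong₂ _*_ feq (geq d))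

  /-exact : ∀ {n} k → (d : suc k ∣ n) → n / suc k ≡ quotient d
  /-exact k (divides q refl) = m*n/n≡m q (suc k)

  ⋆-cong : ∀ {f f′ g g′} → f ≗⁺ f′ → g ≗⁺ g′ → f ⋆ g ≗⁺ f′ ⋆ g′
  ⋆-cong {f} {f′} {g} {g′} feq geq n 1≤n = begin
    (f ⋆ g) n                    ≡⟨ ⋆-as-sumBelow f g n ⟩
    sumBelow (⋆-term f g n) n    ≡⟨ sumBelow-cong n (λ k _ → ⋆-term-cong {f} {f′} {g} {g′} n k 1≤n
                                      (feq (suc k) (s≤s z≤n)) (λ d → geq _ (/≥1 k 1≤n d))) ⟩
    sumBelow (⋆-term f′ g′ n) n  ≡⟨ ⋆-as-sumBelow f′ g′ n ⟨
    (f′ ⋆ g′) n                  ∎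
    where open ≡-Reasoning

  -- The symmetric form of the convolution; the bound M may exceed n, so that nested convolutions can share one bound.
  ⋆-as-double : ∀ f g n M → 1 ≤ n → n ≤ M →
    (f ⋆ g) n ≡ sumBelow (λ a → sumBelow (λ b → when (suc a ℕ.* suc b ℕ.≟ n) (f (suc a) * g (suc b))) M) M
  ⋆-as-double f g n M 1≤n n≤M = begin
    (f ⋆ g) n                  ≡⟨ ⋆-as-sumBelow f g n ⟩
    sumBelow (⋆-term f g n) n  ≡⟨ sumBelow-extend n≤M large ⟨
    sumBelow (⋆-term f g n) M  ≡⟨ sumBelow-cong M (λ a _ → sym (inner a)) ⟩
    _                          ∎
    where
    open ≡-Reasoning
    large : ∀ a → n ≤ a → ⋆-term f g n a ≡ 0ℤ
    large a n≤a = when-no (suc a ∣? n) _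
      (λ d → ℕₚ.<⇒≱ (s≤s n≤a) (∣⇒≤ {{ℕ.>-nonZero 1≤n}} d))
    inner : ∀ a → sumBelow (λ b → when (suc a ℕ.* suc b ℕ.≟ n) (f (suc a) * g (suc b))) M ≡ ⋆-term f g n a
    inner a with suc a ∣? n
    ... | no ¬d = trans
      (sumBelow-zero M (λ b _ → when-no (_ ℕ.≟ n) _
        (λ eq → ¬d (divides (suc b) (trans (sym eq) (ℕₚ.*-comm (suc a) (suc b)))))))
      (sym (when-no (suc a ∣? n) _ ¬d))
    ... | yes (divides zero refl) = contradiction 1≤n λ()
    ... | yes d@(divides (suc q) eq) = trans
      (sumBelow-single q<M (λ b _ b≢q → when-no (_ ℕ.≟ n) _
        (λ eq′ → b≢q (ℕₚ.suc-injective (ℕₚ.*-cancelˡ-≡ (suc b) (suc q) (suc a) (trans eq′ eq″))))))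
      (trans (when-yes (_ ℕ.≟ n) _ (sym eq″))
        (trans (cong (λ x → f (suc a) * g x) (sym (/-exact a d))) (sym (when-yes (suc a ∣? n) _ d))))
      where
      eq″ : n ≡ suc a ℕ.* suc q
      eq″ = trans eq (ℕₚ.*-comm (suc q) (suc a))
      q<M : q < M
      q<M = ℕₚ.≤-trans (ℕₚ.≤-trans (ℕₚ.m≤m*n (suc q) (suc a)) (ℕₚ.≤-reflexive (sym eq))) n≤M

  ⋆-comm : ∀ f g → f ⋆ g ≗⁺ g ⋆ f
  ⋆-comm f g n 1≤n = begin
    (f ⋆ g) n ≡⟨ ⋆-as-double f g n n 1≤n ℕₚ.≤-refl ⟩
    _         ≡⟨ sumBelow-swap (λ a b → when (suc a ℕ.* suc b ℕ.≟ n) (f (suc a) * g (suc b))) n n ⟩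
    _         ≡⟨ sumBelow-cong n (λ b _ → sumBelow-cong n (λ a _ → term a b)) ⟩
    _         ≡⟨ ⋆-as-double g f n n 1≤n ℕₚ.≤-refl ⟨
    (g ⋆ f) n ∎
    where
    open ≡-Reasoning
    term : ∀ a b → when (suc a ℕ.* suc b ℕ.≟ n) (f (suc a) * g (suc b))
                 ≡ when (suc b ℕ.* suc a ℕ.≟ n) (g (suc b) * f (suc a))
    term a b = trans (cong (when (suc a ℕ.* suc b ℕ.≟ n)) (ℤₚ.*-comm (f (suc a)) (g (suc b))))
                     (when-⇔ (suc a ℕ.* suc b ℕ.≟ n) (suc b ℕ.* suc a ℕ.≟ n) _
                       (trans (ℕₚ.*-comm (suc b) (suc a))) (trans (ℕₚ.*-comm (suc a) (suc b))))

  -- The inner convolution is expanded at every x + 1 with the common bound n. Once the sum over x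
  -- is moved innermost, only x + 1 = (b + 1)(c + 1) survives.
  ⋆-as-triple : ∀ f g h n → 1 ≤ n →
    (f ⋆ (g ⋆ h)) n ≡ sumBelow (λ a → sumBelow (λ b → sumBelow (λ c →
      when (suc a ℕ.* (suc b ℕ.* suc c) ℕ.≟ n) (f (suc a) * (g (suc b) * h (suc c)))) n) n) n
  ⋆-as-triple f g h n 1≤n = trans (⋆-as-double f (g ⋆ h) n n 1≤n ℕₚ.≤-refl) (sumBelow-cong n outer)
    where
    open ≡-Reasoning
    outer : ∀ a → a < n → sumBelow (λ x → when (suc a ℕ.* suc x ℕ.≟ n) (f (suc a) * (g ⋆ h) (suc x))) n ≡ _
    outer a _ = begin
      sumBelow (λ x → when (A? x) (F * (g ⋆ h) (suc x))) n
        ≡⟨ sumBelow-cong n expand ⟩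
      sumBelow (λ x → sumBelow (λ b → sumBelow (λ c → t x b c) n) n) n
        ≡⟨ sumBelow-swap (λ x b → sumBelow (λ c → t x b c) n) n n ⟩
      sumBelow (λ b → sumBelow (λ x → sumBelow (λ c → t x b c) n) n) n
        ≡⟨ sumBelow-cong n (λ b _ → sumBelow-swap (λ x c → t x b c) n n) ⟩
      sumBelow (λ b → sumBelow (λ c → sumBelow (λ x → t x b c) n) n) n
        ≡⟨ sumBelow-cong n (λ b _ → sumBelow-cong n (λ c _ → collapse b c)) ⟩
      _ ∎
      where
      F : ℤ
      F = f (suc a)
      A? : ∀ x → Dec (suc a ℕ.* suc x ≡ n)
      A? x = suc a ℕ.* suc x ℕ.≟ n
      t : ℕ → ℕ → ℕ → ℤ
      t x b c = when (A? x) (when (suc b ℕ.* suc c ℕ.≟ suc x) (F * (g (suc b) * h (suc c))))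
      expand : ∀ x → x < n → when (A? x) (F * (g ⋆ h) (suc x)) ≡ sumBelow (λ b → sumBelow (λ c → t x b c) n) n
      expand x x<n = begin
        when (A? x) (F * (g ⋆ h) (suc x))
          ≡⟨ cong (λ z → when (A? x) (F * z)) (⋆-as-double g h (suc x) n (s≤s z≤n) x<n) ⟩
        when (A? x) (F * sumBelow (λ b → sumBelow (λ c → w b c) n) n)
          ≡⟨ cong (when (A? x)) (sumBelow-*ˡ F _ n) ⟩
        when (A? x) (sumBelow (λ b → F * sumBelow (λ c → w b c) n) n)
          ≡⟨ when-sumBelow (A? x) _ n ⟩
        sumBelow (λ b → when (A? x) (F * sumBelow (λ c → w b c) n)) n
          ≡⟨ sumBelow-cong n (λ b _ → trans (cong (when (A? x)) (sumBelow-*ˡ F _ n)) (when-sumBelow (A? x) _ n)) ⟩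
        sumBelow (λ b → sumBelow (λ c → when (A? x) (F * w b c)) n) n
          ≡⟨ sumBelow-cong n (λ b _ → sumBelow-cong n (λ c _ →
               cong (when (A? x)) (when-*ˡ (suc b ℕ.* suc c ℕ.≟ suc x) F _))) ⟩
        _ ∎
        where
        w : ℕ → ℕ → ℤ
        w b c = when (suc b ℕ.* suc c ℕ.≟ suc x) (g (suc b) * h (suc c))
      collapse : ∀ b c → sumBelow (λ x → t x b c) n
        ≡ when (suc a ℕ.* (suc b ℕ.* suc c) ℕ.≟ n) (F * (g (suc b) * h (suc c)))
      collapse b c with (suc a ℕ.* (suc b ℕ.* suc c)) ℕ.≟ n
      ... | yes eq = trans
        (sumBelow-single {k = y} y<n (λ x _ x≢y →
          trans (cong (when (A? x)) (when-no (_ ℕ.≟ suc x) _ (λ eq′ → x≢y (sym (ℕₚ.suc-injective eq′))))) (when-0 (A? x))))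
        (trans (when-yes (A? y) _ eq) (trans (when-yes (_ ℕ.≟ suc y) _ refl) (sym (when-yes (_ ℕ.≟ n) _ eq))))
        where
        -- Chosen so that `suc y` computes to `suc b * suc c`.
        y = c ℕ.+ b ℕ.* suc c
        y<n : y < n
        y<n = ℕₚ.≤-trans (ℕₚ.m≤n*m (suc y) (suc a)) (ℕₚ.≤-reflexive eq)
      ... | no neq = trans (sumBelow-zero n vanish) (sym (when-no (_ ℕ.≟ n) _ neq))
        where
        vanish : ∀ x → x < n → t x b c ≡ 0ℤ
        vanish x _ with (suc b ℕ.* suc c) ℕ.≟ suc x
        ... | yes eq = when-no (A? x) _ (λ eq′ → neq (trans (cong (suc a ℕ.*_) eq) eq′))
        ... | no neq′ = trans (cong (when (A? x)) (when-no (_ ℕ.≟ suc x) _ neq′)) (when-0 (A? x))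

  -- Commuting the outer product brings both sides into the shape of `⋆-as-triple`; the two triple
  -- sums then differ only in the order of summation and of the factors.
  ⋆-assoc : ∀ f g h → (f ⋆ g) ⋆ h ≗⁺ f ⋆ (g ⋆ h)
  ⋆-assoc f g h n 1≤n = begin
    ((f ⋆ g) ⋆ h) n ≡⟨ ⋆-comm (f ⋆ g) h n 1≤n ⟩
    (h ⋆ (f ⋆ g)) n ≡⟨ ⋆-as-triple h f g n 1≤n ⟩
    Σ₃ (λ c a b → u c a b) ≡⟨ sumBelow-swap (λ c a → sumBelow (λ b → u c a b) n) n n ⟩
    Σ₃ (λ a c b → u c a b) ≡⟨ sumBelow-cong n (λ a _ → sumBelow-swap (λ c b → u c a b) n n) ⟩
    Σ₃ (λ a b c → u c a b) ≡⟨ sumBelow-cong n (λ a _ → sumBelow-cong n (λ b _ → sumBelow-cong n (λ c _ → rotate a b c))) ⟩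
    Σ₃ (λ a b c → v a b c) ≡⟨ ⋆-as-triple f g h n 1≤n ⟨
    (f ⋆ (g ⋆ h)) n ∎
    where
    open ≡-Reasoning
    Σ₃ : (ℕ → ℕ → ℕ → ℤ) → ℤ
    Σ₃ k = sumBelow (λ a → sumBelow (λ b → sumBelow (λ c → k a b c) n) n) n
    u v : ℕ → ℕ → ℕ → ℤ
    u c a b = when (suc c ℕ.* (suc a ℕ.* suc b) ℕ.≟ n) (h (suc c) * (f (suc a) * g (suc b)))
    v a b c = when (suc a ℕ.* (suc b ℕ.* suc c) ℕ.≟ n) (f (suc a) * (g (suc b) * h (suc c)))
    rotateℕ : ∀ a b c → c ℕ.* (a ℕ.* b) ≡ a ℕ.* (b ℕ.* c)
    rotateℕ a b c = trans (ℕₚ.*-comm c (a ℕ.* b)) (ℕₚ.*-assoc a b c)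
    rotate : ∀ a b c → u c a b ≡ v a b c
    rotate a b c = trans
      (cong (when (suc c ℕ.* (suc a ℕ.* suc b) ℕ.≟ n))
        (trans (ℤₚ.*-comm (h (suc c)) (f (suc a) * g (suc b))) (ℤₚ.*-assoc (f (suc a)) (g (suc b)) (h (suc c)))))
      (when-⇔ (suc c ℕ.* (suc a ℕ.* suc b) ℕ.≟ n) (suc a ℕ.* (suc b ℕ.* suc c) ℕ.≟ n) _
        (trans (sym (rotateℕ (suc a) (suc b) (suc c)))) (trans (rotateℕ (suc a) (suc b) (suc c))))

  ⋆-sumBelow : ∀ f (g : ℕ → ArithFun) K n → (f ⋆ (λ i → sumBelow (λ L → g L i) K)) n ≡ sumBelow (λ L → (f ⋆ g L) n) K
  ⋆-sumBelow f g K n = begin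
    (f ⋆ (λ i → sumBelow (λ L → g L i) K)) n ≡⟨ ⋆-as-sumBelow f (λ i → sumBelow (λ L → g L i) K) n ⟩
    _ ≡⟨ sumBelow-cong n (λ k _ →
           trans (cong (when (suc k ∣? n)) (sumBelow-*ˡ (f (suc k)) _ K)) (when-sumBelow (suc k ∣? n) _ K)) ⟩
    sumBelow (λ k → sumBelow (λ L → ⋆-term f (g L) n k) K) n ≡⟨ sumBelow-swap (λ k L → ⋆-term f (g L) n k) n K ⟩
    sumBelow (λ L → sumBelow (⋆-term f (g L) n) n) K ≡⟨ sumBelow-cong K (λ L _ → ⋆-as-sumBelow f (g L) n) ⟨
    sumBelow (λ L → (f ⋆ g L) n) K ∎
    where open ≡-Reasoning

  ⋆-*ʳ : ∀ f c g n → (f ⋆ (λ i → c * g i)) n ≡ c * (f ⋆ g) n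
  ⋆-*ʳ f c g n = begin
    (f ⋆ (λ i → c * g i)) n ≡⟨ ⋆-as-sumBelow f (λ i → c * g i) n ⟩
    _ ≡⟨ sumBelow-cong n (λ k _ → trans (cong (when (suc k ∣? n)) (swap c (f (suc k)) _)) (sym (when-*ˡ (suc k ∣? n) c _))) ⟩
    sumBelow (λ k → c * ⋆-term f g n k) n ≡⟨ sumBelow-*ˡ c _ n ⟨
    c * sumBelow (⋆-term f g n) n ≡⟨ cong (c *_) (⋆-as-sumBelow f g n) ⟨
    c * (f ⋆ g) n ∎
    where
    open ≡-Reasoning
    swap : ∀ c x y → x * (c * y) ≡ c * (x * y)
    swap = solve-∀

  ⋆-distribˡ : ∀ f g h n → (f ⋆ (λ i → g i + h i)) n ≡ (f ⋆ g) n + (f ⋆ h) n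
  ⋆-distribˡ f g h n = begin
    (f ⋆ (λ i → g i + h i)) n ≡⟨ ⋆-as-sumBelow f (λ i → g i + h i) n ⟩
    _ ≡⟨ sumBelow-cong n (λ k _ →
           trans (cong (when (suc k ∣? n)) (ℤₚ.*-distribˡ-+ (f (suc k)) _ _)) (when-+ (suc k ∣? n) _ _)) ⟩
    sumBelow (λ k → ⋆-term f g n k + ⋆-term f h n k) n ≡⟨ sumBelow-+ _ _ n ⟩
    sumBelow (⋆-term f g n) n + sumBelow (⋆-term f h n) n ≡⟨ cong₂ _+_ (⋆-as-sumBelow f g n) (⋆-as-sumBelow f h n) ⟨
    (f ⋆ g) n + (f ⋆ h) n ∎
    where open ≡-Reasoning

  -≡-1* : ∀ x → - x ≡ (- (+ 1)) * x
  -≡-1* x = sym (ℤₚ.-1*i≡-i x)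

  ⋆-⊖ˡ : ∀ f g h n → 1 ≤ n → (f ⋆ (g ⊖ h)) n ≡ (f ⋆ g) n - (f ⋆ h) n
  ⋆-⊖ˡ f g h n 1≤n = begin
    (f ⋆ (g ⊖ h)) n
      ≡⟨ ⋆-cong {f} {f} {g ⊖ h} {λ i → g i + (- (+ 1)) * h i} (λ _ _ → refl) (λ i _ → cong (_+_ (g i)) (-≡-1* (h i))) n 1≤n ⟩
    (f ⋆ (λ i → g i + (- (+ 1)) * h i)) n ≡⟨ ⋆-distribˡ f g (λ i → (- (+ 1)) * h i) n ⟩
    (f ⋆ g) n + (f ⋆ (λ i → (- (+ 1)) * h i)) n ≡⟨ cong (_+_ ((f ⋆ g) n)) (trans (⋆-*ʳ f (- (+ 1)) h n) (sym (-≡-1* _))) ⟩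
    (f ⋆ g) n - (f ⋆ h) n ∎
    where open ≡-Reasoning

  ⋆-⊖ʳ : ∀ f g h n → 1 ≤ n → ((f ⊖ g) ⋆ h) n ≡ (f ⋆ h) n - (g ⋆ h) n
  ⋆-⊖ʳ f g h n 1≤n = begin
    ((f ⊖ g) ⋆ h) n       ≡⟨ ⋆-comm (f ⊖ g) h n 1≤n ⟩
    (h ⋆ (f ⊖ g)) n       ≡⟨ ⋆-⊖ˡ h f g n 1≤n ⟩
    (h ⋆ f) n - (h ⋆ g) n ≡⟨ cong₂ _-_ (⋆-comm h f n 1≤n) (⋆-comm h g n 1≤n) ⟩
    (f ⋆ h) n - (g ⋆ h) n ∎
    where open ≡-Reasoning

  ⋆-identityˡ : ∀ f → e ⋆ f ≗⁺ f
  ⋆-identityˡ f n 1≤n = begin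
    (e ⋆ f) n                 ≡⟨ ⋆-as-sumBelow e f n ⟩
    sumBelow (⋆-term e f n) n ≡⟨ sumBelow-single 1≤n others ⟩
    ⋆-term e f n 0            ≡⟨ when-yes (1 ∣? n) _ (1∣ n) ⟩
    + 1 * f (n / 1)           ≡⟨ ℤₚ.*-identityˡ _ ⟩
    f (n / 1)                 ≡⟨ cong f (n/1≡n n) ⟩
    f n                       ∎
    where
    open ≡-Reasoning
    others : ∀ k → k < n → k ≢ 0 → ⋆-term e f n k ≡ 0ℤ
    others zero    _ k≢0 = contradiction refl k≢0
    others (suc k) _ _   = trans (cong (when (suc (suc k) ∣? n)) refl) (when-0 (suc (suc k) ∣? n))

  ⋆-identityʳ : ∀ f → f ⋆ e ≗⁺ f
  ⋆-identityʳ f n 1≤n = trans (⋆-comm f e n 1≤n) (⋆-identityˡ f n 1≤n)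

  -- The Möbius function summed over divisors.

  squareDivides? : ∀ n k → Dec (suc (suc k) ℕ.* suc (suc k) ∣ n)
  squareDivides? n k = suc (suc k) ℕ.* suc (suc k) ∣? n

  all-upTo : ∀ (f : ℕ → Bool) K →
    List.foldr _∧_ true (List.map f (upTo K)) ≡ List.foldr _∧_ true (applyUpTo f K)
  all-upTo f K = cong (List.foldr _∧_ true) (map-applyUpTo id f K)

  all-applyUpTo-true : ∀ (f : ℕ → Bool) K → (∀ k → k < K → f k ≡ true) →
    List.foldr _∧_ true (applyUpTo f K) ≡ true
  all-applyUpTo-true f zero    all = refl
  all-applyUpTo-true f (suc K) all rewrite all 0 (s≤s z≤n) =
    all-applyUpTo-true (f ∘ suc) K (λ k k<K → all (suc k) (s≤s k<K))

  all-applyUpTo-false : ∀ (f : ℕ → Bool) K k → k < K → f k ≡ false →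
    List.foldr _∧_ true (applyUpTo f K) ≡ false
  all-applyUpTo-false f (suc K) zero    _         eq rewrite eq = refl
  all-applyUpTo-false f (suc K) (suc k) (s≤s k<K) eq with f 0
  ... | true  = all-applyUpTo-false (f ∘ suc) K k k<K eq
  ... | false = refl

  -- The shift by two leaves only squares of numbers at least 2, as in `squarefree`, but the witness
  -- is not tied to a search range, so it can be carried from p d to d and back.
  HasSquare : ℕ → Set
  HasSquare n = ∃ λ k → suc (suc k) ℕ.* suc (suc k) ∣ n

  squarefree-true : ∀ n → ¬ HasSquare n → squarefree n ≡ true
  squarefree-true n ¬sq = trans (all-upTo _ n)
    (all-applyUpTo-true _ n (λ k _ → cong not (dec-false (squareDivides? n k) (¬sq ∘ (k ,_)))))

  squarefree-false : ∀ n → 1 ≤ n → HasSquare n → squarefree n ≡ false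
  squarefree-false n 1≤n (k , d) = trans (all-upTo _ n)
    (all-applyUpTo-false _ n k k<n (cong not (dec-true (squareDivides? n k) d)))
    where
    k<n : k < n
    k<n = ℕₚ.≤-trans (ℕₚ.n≤1+n (suc k)) (ℕₚ.≤-trans (ℕₚ.m≤m*n (suc (suc k)) (suc (suc k))) (∣⇒≤ {{ℕ.>-nonZero 1≤n}} d))

  μ-hasSquare : ∀ n → 1 ≤ n → HasSquare n → μ n ≡ 0ℤ
  μ-hasSquare n 1≤n sq rewrite squarefree-false n 1≤n sq = refl

  ¬hasSquare : ∀ n → 1 ≤ n → squarefree n ≡ true → ¬ HasSquare n
  ¬hasSquare n 1≤n eq sq with trans (sym eq) (squarefree-false n 1≤n sq)
  ... | ()

  squarefree-⇔ : ∀ m n → 1 ≤ m → 1 ≤ n → (HasSquare m → HasSquare n) → (HasSquare n → HasSquare m) →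
    squarefree m ≡ squarefree n
  squarefree-⇔ m n 1≤m 1≤n f g with squarefree m in eqm | squarefree n in eqn
  ... | true  | true  = refl
  ... | false | false = refl
  ... | true  | false = trans (sym (squarefree-true n (¬hasSquare m 1≤m eqm ∘ g))) eqn
  ... | false | true  = trans (sym eqm) (squarefree-true m (¬hasSquare n 1≤n eqn ∘ f))

  primeDivisor? : ∀ n q → Dec (Prime q × q ∣ n)
  primeDivisor? n q = prime? q ×-dec (q ∣? n)

  filter-length : ∀ {P : ℕ → Set} (P? : ∀ i → Dec (P i)) (f : ℕ → ℕ) K →
    + length (filter P? (applyUpTo f K)) ≡ sumBelow (λ i → when (P? (f i)) (+ 1)) K
  filter-length P? f zero    = refl
  filter-length P? f (suc K) = trans step (sym (sumBelow-suc _ K))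
    where
    step : + length (filter P? (applyUpTo f (suc K)))
         ≡ when (P? (f 0)) (+ 1) + sumBelow (λ i → when (P? (f (suc i))) (+ 1)) K
    step with does (P? (f 0))
    ... | true  = cong (_+_ (+ 1)) (filter-length P? (f ∘ suc) K)
    ... | false = trans (filter-length P? (f ∘ suc) K) (sym (ℤₚ.+-identityˡ _))

  -- The free bound M lets ω(d) and ω(p d) be compared term by term over one range.
  ω-as-sumBelow : ∀ n M → 1 ≤ n → n < M → + ω n ≡ sumBelow (λ q → when (primeDivisor? n q) (+ 1)) M
  ω-as-sumBelow n M 1≤n n<M = trans (filter-length (primeDivisor? n) id (suc n))
    (sym (sumBelow-extend n<M (λ q n<q → when-no (primeDivisor? n q) _
      (λ (_ , d) → ℕₚ.<⇒≱ n<q (∣⇒≤ {{ℕ.>-nonZero 1≤n}} d)))))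

  module _ {p : ℕ} (prm : Prime p) where

    prime≥1 : 1 ≤ p
    prime≥1 = ℕ.>-nonZero⁻¹ p {{prime⇒nonZero prm}}

    prime∣prime : ∀ {q} → Prime q → q ∣ p → q ≡ p
    prime∣prime prq d with prime⇒irreducible prm d
    ... | inj₁ refl = contradiction prq ¬prime[1]
    ... | inj₂ eq   = eq

    prime-coprime : ∀ {k} → ¬ p ∣ k → Coprime k p
    prime-coprime p∤k (i∣k , i∣p) with prime⇒irreducible prm i∣p
    ... | inj₁ eq   = eq
    ... | inj₂ refl = contradiction i∣k p∤k

    module _ {d : ℕ} (1≤d : 1 ≤ d) (p∤d : ¬ p ∣ d) where

      1≤p*d : 1 ≤ p ℕ.* d
      1≤p*d = ℕₚ.*-mono-≤ prime≥1 1≤d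

      -- Let k² divide p d. If p divided k, then p² would divide p d and p would divide d. Hence k²
      -- is coprime to p and divides d.
      hasSquare-*prime : HasSquare (p ℕ.* d) → HasSquare d
      hasSquare-*prime (k , dv) with p ∣? suc (suc k)
      ... | yes p∣k = contradiction
        (*-cancelˡ-∣ p {{prime⇒nonZero prm}} (∣-trans (*-pres-∣ p∣k p∣k) dv)) p∤d
      ... | no p∤k  = k , coprime-divisor (prime-coprime ([ p∤k , p∤k ]′ ∘ euclidsLemma (suc (suc k)) (suc (suc k)) prm)) dv

      -- The prime divisors of p d are p and those of d, and p is not among the latter.
      ω-*prime : ω (p ℕ.* d) ≡ suc (ω d)
      ω-*prime = ℤₚ.+-injective (begin
        + ω (p ℕ.* d)
          ≡⟨ ω-as-sumBelow (p ℕ.* d) M 1≤p*d ℕₚ.≤-refl ⟩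
        sumBelow (λ q → when (primeDivisor? (p ℕ.* d) q) (+ 1)) M
          ≡⟨ sumBelow-cong M (λ q _ → pointwise q) ⟩
        sumBelow (λ q → when (q ℕ.≟ p) (+ 1) + when (primeDivisor? d q) (+ 1)) M
          ≡⟨ sumBelow-+ _ _ M ⟩
        sumBelow (λ q → when (q ℕ.≟ p) (+ 1)) M + sumBelow (λ q → when (primeDivisor? d q) (+ 1)) M
          ≡⟨ cong₂ _+_
               (trans (sumBelow-single p<M (λ q _ q≢p → when-no (q ℕ.≟ p) _ q≢p)) (when-yes (p ℕ.≟ p) _ refl))
               (sym (ω-as-sumBelow d M 1≤d (s≤s (ℕₚ.m≤n*m d p {{prime⇒nonZero prm}})))) ⟩
        + 1 + + ω d ∎)
        where
        open ≡-Reasoning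
        M : ℕ
        M = suc (p ℕ.* d)
        p<M : p < M
        p<M = s≤s (ℕₚ.m≤m*n p d {{ℕ.>-nonZero 1≤d}})
        pointwise : ∀ q → when (primeDivisor? (p ℕ.* d) q) (+ 1)
                        ≡ when (q ℕ.≟ p) (+ 1) + when (primeDivisor? d q) (+ 1)
        pointwise q = by-cases (q ℕ.≟ p)
          where
          by-cases : Dec (q ≡ p) → when (primeDivisor? (p ℕ.* d) q) (+ 1)
                        ≡ when (q ℕ.≟ p) (+ 1) + when (primeDivisor? d q) (+ 1)
          by-cases (yes refl) = trans (when-yes (primeDivisor? (p ℕ.* d) p) _ (prm , m∣m*n d))
            (sym (cong₂ _+_ (when-yes (p ℕ.≟ p) _ refl) (when-no (primeDivisor? d p) (+ 1) (p∤d ∘ proj₂))))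
          by-cases (no q≢p) = trans
            (when-⇔ (primeDivisor? (p ℕ.* d) q) (primeDivisor? d q) (+ 1)
              (λ (prq , dv) → prq , [ (λ q∣p → contradiction (prime∣prime prq q∣p) q≢p) , id ]′ (euclidsLemma p d prq dv))
              (λ (prq , dv) → prq , ∣n⇒∣m*n p dv))
            (sym (trans (cong (_+ when (primeDivisor? d q) (+ 1)) (when-no (q ℕ.≟ p) _ q≢p)) (ℤₚ.+-identityˡ _)))

      μ-*prime : μ (p ℕ.* d) ≡ - μ d
      μ-*prime
        rewrite squarefree-⇔ (p ℕ.* d) d 1≤p*d 1≤d hasSquare-*prime (λ (k , dv) → k , ∣n⇒∣m*n p dv)
              | ω-*prime
        with squarefree d
      ... | true  = ℤₚ.-1*i≡-i _
      ... | false = refl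

      *prime-∣ : ∀ {n} → p ∣ n → d ∣ n → p ℕ.* d ∣ n
      *prime-∣ p∣n (divides q refl) with euclidsLemma q d prm p∣n
      ... | inj₁ p∣q = *-monoˡ-∣ d p∣q
      ... | inj₂ p∣d = contradiction p∣d p∤d

  prime-divisor : ∀ n → 2 ≤ n → ∃ λ p → Prime p × p ∣ n
  prime-divisor n 2≤n with factorise n {{ℕ.>-nonZero (ℕₚ.<⇒≤ 2≤n)}}
  ... | record { factors = [] ; isFactorisation = refl } = contradiction 2≤n λ { (s≤s ()) }
  ... | record { factors = p ∷ ps ; isFactorisation = eq ; factorsPrime = prm ∷ _ } =
    p , prm , subst (p ∣_) (sym eq) (m∣m*n _)

  -- Reindexing by k + 1 = p (j + 1). As H vanishes beyond n, j may run up to n instead of n/p, so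
  -- that the multiples of p can be paired with the other divisors within a single sum.
  sumBelow-multiples : ∀ (H : ℕ → ℤ) p n → 1 ≤ p → (∀ d → n < d → H d ≡ 0ℤ) →
    sumBelow (λ k → when (p ∣? suc k) (H (suc k))) n ≡ sumBelow (λ j → H (p ℕ.* suc j)) n
  sumBelow-multiples H (suc p) n _ vanish = begin
    sumBelow (λ k → when (suc p ∣? suc k) (H (suc k))) n
      ≡⟨ sumBelow-cong n (λ k k<n → spread k k<n) ⟩
    sumBelow (λ k → sumBelow (λ j → when (suc p ℕ.* suc j ℕ.≟ suc k) (H (suc k))) n) n
      ≡⟨ sumBelow-swap (λ k j → when (suc p ℕ.* suc j ℕ.≟ suc k) (H (suc k))) n n ⟩
    sumBelow (λ j → sumBelow (λ k → when (suc p ℕ.* suc j ℕ.≟ suc k) (H (suc k))) n) n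
      ≡⟨ sumBelow-cong n (λ j _ → collapse j) ⟩
    sumBelow (λ j → H (suc p ℕ.* suc j)) n ∎
    where
    open ≡-Reasoning
    spread : ∀ k → k < n →
      when (suc p ∣? suc k) (H (suc k)) ≡ sumBelow (λ j → when (suc p ℕ.* suc j ℕ.≟ suc k) (H (suc k))) n
    spread k k<n = by-cases (suc p ∣? suc k)
      where
      by-cases : Dec (suc p ∣ suc k) →
        when (suc p ∣? suc k) (H (suc k)) ≡ sumBelow (λ j → when (suc p ℕ.* suc j ℕ.≟ suc k) (H (suc k))) n
      by-cases (no ¬d) = trans (when-no (suc p ∣? suc k) _ ¬d)
        (sym (sumBelow-zero n (λ j _ → when-no (_ ℕ.≟ suc k) _
          (λ eq → ¬d (divides (suc j) (trans (sym eq) (ℕₚ.*-comm (suc p) (suc j))))))))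
      by-cases (yes d@(divides (suc j) eq)) = trans (when-yes (suc p ∣? suc k) _ d)
        (sym (trans (sumBelow-single j<n (λ i _ i≢j → when-no (_ ℕ.≟ suc k) _
                (λ eq″ → i≢j (ℕₚ.suc-injective (ℕₚ.*-cancelˡ-≡ (suc i) (suc j) (suc p) (trans eq″ eq′))))))
          (when-yes (_ ℕ.≟ suc k) _ (sym eq′))))
        where
        eq′ : suc k ≡ suc p ℕ.* suc j
        eq′ = trans eq (ℕₚ.*-comm (suc j) (suc p))
        j<n : j < n
        j<n = ℕₚ.≤-trans (ℕₚ.≤-trans (ℕₚ.m≤m*n (suc j) (suc p)) (ℕₚ.≤-reflexive (sym eq))) k<n
    collapse : ∀ j → sumBelow (λ k → when (suc p ℕ.* suc j ℕ.≟ suc k) (H (suc k))) n ≡ H (suc p ℕ.* suc j)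
    collapse j with suc p ℕ.* suc j ℕ.≤? n
    ... | yes le = trans
      (sumBelow-single le (λ k _ k≢ → when-no (_ ℕ.≟ suc k) _ (λ eq → k≢ (sym (ℕₚ.suc-injective eq)))))
      (when-yes (suc p ℕ.* suc j ℕ.≟ suc p ℕ.* suc j) _ refl)
    ... | no nle = trans
      (sumBelow-zero n (λ k k<n → when-no (_ ℕ.≟ suc k) _ (λ eq → nle (subst (_≤ n) (sym eq) k<n))))
      (sym (vanish _ (ℕₚ.≰⇒> nle)))

  -- Fix a prime p ∣ n.  The divisors d of n with p ∤ d cancel against their multiples p d, and the remaining divisors
  -- are not squarefree.
  ∑μ : ∀ n → 2 ≤ n → sumBelow (λ k → when (suc k ∣? n) (μ (suc k))) n ≡ 0ℤ
  ∑μ n 2≤n with prime-divisor n 2≤n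
  ... | p , prm , p∣n = begin
    sumBelow (H ∘ suc) n
      ≡⟨ sumBelow-cong n (λ k _ → split (p ∣? suc k) (H (suc k))) ⟩
    sumBelow (λ k → when (¬? (p ∣? suc k)) (H (suc k)) + when (p ∣? suc k) (H (suc k))) n
      ≡⟨ sumBelow-+ _ _ n ⟩
    sumBelow (λ k → when (¬? (p ∣? suc k)) (H (suc k))) n + sumBelow (λ k → when (p ∣? suc k) (H (suc k))) n
      ≡⟨ cong (_+_ (sumBelow (λ k → when (¬? (p ∣? suc k)) (H (suc k))) n))
           (sumBelow-multiples H p n (prime≥1 prm) vanish) ⟩
    sumBelow (λ k → when (¬? (p ∣? suc k)) (H (suc k))) n + sumBelow (λ k → H (p ℕ.* suc k)) n
      ≡⟨ sumBelow-+ _ _ n ⟨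
    sumBelow (λ k → when (¬? (p ∣? suc k)) (H (suc k)) + H (p ℕ.* suc k)) n
      ≡⟨ sumBelow-zero n (λ k _ → cancel k (p ∣? suc k)) ⟩
    0ℤ ∎
    where
    open ≡-Reasoning
    1≤n : 1 ≤ n
    1≤n = ℕₚ.<⇒≤ 2≤n
    H : ℕ → ℤ
    H d = when (d ∣? n) (μ d)
    vanish : ∀ d → n < d → H d ≡ 0ℤ
    vanish d n<d = when-no (d ∣? n) _ (λ dv → ℕₚ.<⇒≱ n<d (∣⇒≤ {{ℕ.>-nonZero 1≤n}} dv))
    split : ∀ {P : Set} (P? : Dec P) z → z ≡ when (¬? P?) z + when P? z
    split (yes _) z = sym (ℤₚ.+-identityˡ z)
    split (no _)  z = sym (ℤₚ.+-identityʳ z)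
    cancel : ∀ k → Dec (p ∣ suc k) → when (¬? (p ∣? suc k)) (H (suc k)) + H (p ℕ.* suc k) ≡ 0ℤ
    cancel k (yes p∣k) = cong₂ _+_ (when-no (¬? (p ∣? suc k)) _ (λ ¬d → ¬d p∣k))
      (trans (cong (when (p ℕ.* suc k ∣? n)) (square k p∣k)) (when-0 (p ℕ.* suc k ∣? n)))
      where
      square : ∀ k → p ∣ suc k → μ (p ℕ.* suc k) ≡ 0ℤ
      square k p∣k = μ-hasSquare (p ℕ.* suc k) (ℕₚ.*-mono-≤ (prime≥1 prm) (s≤s z≤n)) (witness p prm p∣k)
        where
        witness : ∀ p → Prime p → p ∣ suc k → HasSquare (p ℕ.* suc k)
        witness zero          pr _   = contradiction pr ¬prime[0]
        witness (suc zero)    pr _   = contradiction pr ¬prime[1]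
        witness (suc (suc r)) _  dv  = r , *-monoʳ-∣ (suc (suc r)) dv
    cancel k (no p∤k) = begin
      when (¬? (p ∣? suc k)) (H (suc k)) + H (p ℕ.* suc k)
        ≡⟨ cong₂ _+_ (when-yes (¬? (p ∣? suc k)) _ p∤k)
             (trans (when-⇔ (p ℕ.* suc k ∣? n) (suc k ∣? n) _ (∣-trans (n∣m*n p)) (*prime-∣ prm (s≤s z≤n) p∤k p∣n))
                    (cong (when (suc k ∣? n)) (μ-*prime prm (s≤s z≤n) p∤k))) ⟩
      H (suc k) + when (suc k ∣? n) (- μ (suc k))
        ≡⟨ when-+ (suc k ∣? n) _ _ ⟨
      when (suc k ∣? n) (μ (suc k) - μ (suc k))
        ≡⟨ cong (when (suc k ∣? n)) (ℤₚ.+-inverseʳ (μ (suc k))) ⟩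
      when (suc k ∣? n) 0ℤ
        ≡⟨ when-0 (suc k ∣? n) ⟩
      0ℤ ∎

  one⋆μ : one ⋆ μ ≗⁺ e
  one⋆μ n 1≤n = trans (⋆-comm one μ n 1≤n) (trans (⋆-as-sumBelow μ one n)
    (trans (sumBelow-cong n (λ k _ → cong (when (suc k ∣? n)) (ℤₚ.*-identityʳ (μ (suc k))))) (value n 1≤n)))
    where
    value : ∀ n → 1 ≤ n → sumBelow (λ k → when (suc k ∣? n) (μ (suc k))) n ≡ e n
    value (suc zero)    _ = refl
    value (suc (suc n)) _ = ∑μ (suc (suc n)) (s≤s (s≤s z≤n))

  -- The function e - μ and its convolution powers.

  ε : ArithFun
  ε = e ⊖ μ

  one⊖e⋆μ : (one ⊖ e) ⋆ μ ≗⁺ ε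
  one⊖e⋆μ n 1≤n = trans (⋆-⊖ʳ one e μ n 1≤n) (cong₂ _-_ (one⋆μ n 1≤n) (⋆-identityˡ μ n 1≤n))

  one⋆ε : one ⋆ ε ≗⁺ one ⊖ e
  one⋆ε n 1≤n = trans (⋆-⊖ˡ one e μ n 1≤n) (cong₂ _-_ (⋆-identityʳ one n 1≤n) (one⋆μ n 1≤n))

  -- Used to pair each factor 1 - e of `c` with a factor μ.
  ⋆-interchange : ∀ f g h k → (f ⋆ g) ⋆ (h ⋆ k) ≗⁺ (f ⋆ h) ⋆ (g ⋆ k)
  ⋆-interchange f g h k n 1≤n = begin
    ((f ⋆ g) ⋆ (h ⋆ k)) n   ≡⟨ ⋆-assoc f g (h ⋆ k) n 1≤n ⟩
    (f ⋆ (g ⋆ (h ⋆ k))) n   ≡⟨ ⋆-cong {f} {f} {g ⋆ (h ⋆ k)} {h ⋆ (g ⋆ k)} (λ _ _ → refl) inner n 1≤n ⟩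
    (f ⋆ (h ⋆ (g ⋆ k))) n   ≡⟨ ⋆-assoc f h (g ⋆ k) n 1≤n ⟨
    ((f ⋆ h) ⋆ (g ⋆ k)) n   ∎
    where
    open ≡-Reasoning
    inner : g ⋆ (h ⋆ k) ≗⁺ h ⋆ (g ⋆ k)
    inner n 1≤n = begin
      (g ⋆ (h ⋆ k)) n ≡⟨ ⋆-assoc g h k n 1≤n ⟨
      ((g ⋆ h) ⋆ k) n ≡⟨ ⋆-cong {g ⋆ h} {h ⋆ g} {k} {k} (⋆-comm g h) (λ _ _ → refl) n 1≤n ⟩
      ((h ⋆ g) ⋆ k) n ≡⟨ ⋆-assoc h g k n 1≤n ⟩
      (h ⋆ (g ⋆ k)) n ∎

  c-as-power : ∀ L → c L ≗⁺ ε ^⋆ L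
  c-as-power zero    = ⋆-identityˡ e
  c-as-power (suc L) n 1≤n = trans
    (⋆-interchange (one ⊖ e) ((one ⊖ e) ^⋆ L) μ (μ ^⋆ L) n 1≤n)
    (⋆-cong {(one ⊖ e) ⋆ μ} {ε} {c L} {ε ^⋆ L} one⊖e⋆μ (c-as-power L) n 1≤n)

  -- Since e - μ vanishes at 1, each factor takes a divisor of at least 2 out of n and so lowers the
  -- remaining argument by at least 1.
  ε-power-vanishes : ∀ L n → 1 ≤ n → n ≤ L → (ε ^⋆ L) n ≡ 0ℤ
  ε-power-vanishes zero    n 1≤n n≤L = contradiction (ℕₚ.≤-trans 1≤n n≤L) λ()
  ε-power-vanishes (suc L) n 1≤n n≤L = trans (⋆-as-sumBelow ε (ε ^⋆ L) n) (sumBelow-zero n vanish)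
    where
    vanish : ∀ k → k < n → ⋆-term ε (ε ^⋆ L) n k ≡ 0ℤ
    -- Here `ε 1` = 1 - μ(1) evaluates to 0.
    vanish zero    _ = when-0 (1 ∣? n)
    vanish (suc k) _ = trans (when-cong (suc (suc k) ∣? n)
        (λ d → trans (cong (_*_ (ε (suc (suc k)))) (ε-power-vanishes L _ (/≥1 (suc k) 1≤n d) (smaller d)))
                     (ℤₚ.*-zeroʳ (ε (suc (suc k))))))
      (when-0 (suc (suc k) ∣? n))
      where
      smaller : suc (suc k) ∣ n → n / suc (suc k) ≤ L
      smaller d = ℕₚ.≤-pred (ℕₚ.≤-trans
        (m/n<m n (suc (suc k)) {{ℕ.>-nonZero 1≤n}} (s≤s (s≤s z≤n))) n≤L)

  -- With b = (e − μ) ⋆ x this says b = (1 − e) ⋆ (x − b), the recursion satisfied by the systems with a marked part.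
  ε⋆-recursion : ∀ x → ε ⋆ x ≗⁺ (one ⊖ e) ⋆ (x ⊖ (ε ⋆ x))
  ε⋆-recursion x n 1≤n = begin
    b n                                                    ≡⟨ cancel (b n) ((one ⋆ b) n) ⟩
    (one ⋆ b) n - ((one ⋆ b) n - b n)                      ≡⟨ cong₂ _-_ (one⋆b n 1≤n) (sym one⊖e⋆b) ⟩
    ((one ⊖ e) ⋆ x) n - ((one ⊖ e) ⋆ b) n                  ≡⟨ ⋆-⊖ˡ (one ⊖ e) x b n 1≤n ⟨
    ((one ⊖ e) ⋆ (x ⊖ b)) n                                ∎
    where
    open ≡-Reasoning
    b : ArithFun
    b = ε ⋆ x
    cancel : ∀ y z → y ≡ z - (z - y)
    cancel = solve-∀
    one⋆b : one ⋆ b ≗⁺ (one ⊖ e) ⋆ x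
    one⋆b n 1≤n = trans (sym (⋆-assoc one ε x n 1≤n))
      (⋆-cong {one ⋆ ε} {one ⊖ e} {x} {x} one⋆ε (λ _ _ → refl) n 1≤n)
    one⊖e⋆b : ((one ⊖ e) ⋆ b) n ≡ (one ⋆ b) n - b n
    one⊖e⋆b = trans (⋆-⊖ʳ one e b n 1≤n) (cong (_-_ ((one ⋆ b) n)) (⋆-identityˡ b n 1≤n))

  -- Only arguments up to n enter a convolution at n. This allows a function whose summation bound
  -- varies with its argument to be replaced by one with the fixed bound n.
  ⋆-congʳ-≤ : ∀ f {g g′} n → 1 ≤ n → (∀ i → 1 ≤ i → i ≤ n → g i ≡ g′ i) → (f ⋆ g) n ≡ (f ⋆ g′) n
  ⋆-congʳ-≤ f {g} {g′} n 1≤n eq = begin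
    (f ⋆ g) n                  ≡⟨ ⋆-as-sumBelow f g n ⟩
    sumBelow (⋆-term f g n) n  ≡⟨ sumBelow-cong n (λ k _ → ⋆-term-cong {f} {f} {g} {g′} n k 1≤n refl
                                    (λ d → eq _ (/≥1 k 1≤n d) (m/n≤m n (suc k)))) ⟩
    sumBelow (⋆-term f g′ n) n ≡⟨ ⋆-as-sumBelow f g′ n ⟨
    (f ⋆ g′) n                 ∎
    where open ≡-Reasoning

  -- The closed formula and its recursion in the number of parts.

  surjections : ℕ → ℕ → ℤ
  surjections L m = + (m ! ℕ.* S L m)

  surjections-suc : ∀ L m → surjections (suc L) (suc m) ≡ + suc m * (surjections L (suc m) + surjections L m)
  surjections-suc L m = trans
    (cong +_ (identity (suc m) (m !) (S L (suc m)) (S L m)))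
    (trans (ℤₚ.pos-* (suc m) _) (cong (_*_ (+ suc m)) (ℤₚ.pos-+ (suc m ! ℕ.* S L (suc m)) (m ! ℕ.* S L m))))
    where
    identity : ∀ k f s t → (k ℕ.* f) ℕ.* (k ℕ.* s ℕ.+ t) ≡ k ℕ.* ((k ℕ.* f) ℕ.* s ℕ.+ f ℕ.* t)
    identity = ℕ-solve-∀

  -- The series of the theorem, cut at L < n because all later terms vanish by `ε-power-vanishes`.
  systemCount : ℕ → ArithFun
  systemCount m n = sumBelow (λ L → surjections L m * (ε ^⋆ L) n) n

  systemCount-bound : ∀ m n K → 1 ≤ n → n ≤ K → sumBelow (λ L → surjections L m * (ε ^⋆ L) n) K ≡ systemCount m n
  systemCount-bound m n K 1≤n n≤K = sumBelow-extend n≤K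
    (λ L n≤L → trans (cong (_*_ (surjections L m)) (ε-power-vanishes L n 1≤n n≤L)) (ℤₚ.*-zeroʳ (surjections L m)))

  systemCount-zero : systemCount 0 ≗⁺ e
  systemCount-zero n 1≤n = trans (sumBelow-single 1≤n vanish) (ℤₚ.*-identityˡ (e n))
    where
    vanish : ∀ L → L < n → L ≢ 0 → surjections L 0 * (ε ^⋆ L) n ≡ 0ℤ
    vanish zero    _ L≢0 = contradiction refl L≢0
    vanish (suc L) _ _   = refl

  -- Here m is the number of parts other than the distinguished part j. The two summands of
  -- `almostCount` correspond to part j being nontrivial or equal to {0}.
  almostCount markedCount : ℕ → ArithFun
  almostCount m n = systemCount (suc m) n + systemCount m n
  markedCount m = ε ⋆ almostCount m

  -- With the common bound n for all arguments i ≤ n, the convolution passes through the sum over L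
  -- and raises each power by one.
  ε⋆systemCount : ∀ m n → 1 ≤ n → (ε ⋆ systemCount m) n ≡ sumBelow (λ L → surjections L m * (ε ^⋆ suc L) n) n
  ε⋆systemCount m n 1≤n = begin
    (ε ⋆ systemCount m) n
      ≡⟨ ⋆-congʳ-≤ ε {systemCount m} {λ i → sumBelow (λ L → surjections L m * (ε ^⋆ L) i) n} n 1≤n
           (λ i 1≤i i≤n → sym (systemCount-bound m i n 1≤i i≤n)) ⟩
    (ε ⋆ (λ i → sumBelow (λ L → surjections L m * (ε ^⋆ L) i) n)) n
      ≡⟨ ⋆-sumBelow ε (λ L i → surjections L m * (ε ^⋆ L) i) n n ⟩
    sumBelow (λ L → (ε ⋆ (λ i → surjections L m * (ε ^⋆ L) i)) n) n
      ≡⟨ sumBelow-cong n (λ L _ → ⋆-*ʳ ε (surjections L m) (ε ^⋆ L) n) ⟩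
    sumBelow (λ L → surjections L m * (ε ^⋆ suc L) n) n ∎
    where open ≡-Reasoning

  systemCount-suc : ∀ m n → 1 ≤ n → systemCount (suc m) n ≡ + suc m * markedCount m n
  systemCount-suc m n 1≤n = begin
    systemCount (suc m) n
      -- The range is lengthened by one, so that n terms remain after L = 0 is split off; the term L
      -- = 0 vanishes because S(0, m + 1) = 0.
      ≡⟨ systemCount-bound (suc m) n (suc n) 1≤n (ℕₚ.n≤1+n n) ⟨
    sumBelow (λ L → surjections L (suc m) * (ε ^⋆ L) n) (suc n)
      ≡⟨ sumBelow-suc (λ L → surjections L (suc m) * (ε ^⋆ L) n) n ⟩
    surjections 0 (suc m) * e n + sumBelow (λ L → surjections (suc L) (suc m) * a (suc L)) n
      ≡⟨ cong₂ _+_ (cong (λ x → + x * e n) (ℕₚ.*-zeroʳ (suc m !)))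
           (sumBelow-cong n (λ L _ → trans (cong (_* a (suc L)) (surjections-suc L m))
             (distribute (+ suc m) (surjections L (suc m)) (surjections L m) (a (suc L))))) ⟩
    0ℤ + sumBelow (λ L → + suc m * (surjections L (suc m) * a (suc L) + surjections L m * a (suc L))) n
      ≡⟨ ℤₚ.+-identityˡ _ ⟩
    sumBelow (λ L → + suc m * (surjections L (suc m) * a (suc L) + surjections L m * a (suc L))) n
      ≡⟨ sumBelow-*ˡ (+ suc m) _ n ⟨
    + suc m * sumBelow (λ L → surjections L (suc m) * a (suc L) + surjections L m * a (suc L)) n
      ≡⟨ cong (_*_ (+ suc m)) (begin
           sumBelow (λ L → surjections L (suc m) * a (suc L) + surjections L m * a (suc L)) n
             ≡⟨ sumBelow-+ _ _ n ⟩
           sumBelow (λ L → surjections L (suc m) * a (suc L)) n + sumBelow (λ L → surjections L m * a (suc L)) n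
             ≡⟨ cong₂ _+_ (ε⋆systemCount (suc m) n 1≤n) (ε⋆systemCount m n 1≤n) ⟨
           (ε ⋆ systemCount (suc m)) n + (ε ⋆ systemCount m) n
             ≡⟨ ⋆-distribˡ ε (systemCount (suc m)) (systemCount m) n ⟨
           markedCount m n ∎) ⟩
    + suc m * markedCount m n ∎
    where
    open ≡-Reasoning
    a : ℕ → ℤ
    a L = (ε ^⋆ L) n
    distribute : ∀ k s t x → k * (s + t) * x ≡ k * (s * x + t * x)
    distribute = solve-∀

-- De Bruijn's dichotomy for two summands.

module SumSystems where

  open import Data.Nat using (_+_; _*_; _∸_)

  -- De Bruijn's dichotomy for A ⊕ C = {0,…,N−1} where 0,…,d−1 are in A and d is not: every block {q d,…,q d + d−1} is
  -- contained in A or disjoint from A, and meets C at most in q d.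
  module DirectSum
    {A C : ℕ → Set} {N : ℕ}
    (bounded : ∀ {x y} → A x → C y → x + y < N)
    (covers  : ∀ {n} → n < N → ∃ λ x → ∃ λ y → A x × C y × x + y ≡ n)
    (unique  : ∀ {x y x′ y′} → A x → C y → A x′ → C y′ → x + y ≡ x′ + y′ → x ≡ x′ × y ≡ y′)
    (0∈A : A 0) (0∈C : C 0)
    (d′ : ℕ)
    (initial : ∀ {x} → x < suc d′ → A x)
    (d∉A : ¬ A (suc d′))
    where

    private
      d : ℕ
      d = suc d′

    -- Containment in A and disjointness from A are both expressed through the left endpoint q d, so
    -- no decision on q d ∈ A is required. Blocks beyond N satisfy all clauses vacuously.
    record Block (q : ℕ) : Set where
      field
        C-start  : ∀ {r} → r < d → C (r + q * d) → r ≡ 0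
        A-fill   : ∀ {r} → r < d → A (q * d) → A (r + q * d)
        A-start  : ∀ {r} → r < d → A (r + q * d) → A (q * d)
    open Block

    private
      A<N : ∀ {x} → A x → x < N
      A<N {x} a = subst (_< N) (+-identityʳ x) (bounded a 0∈C)

      complement : ∀ {p q} → p ≤ q → (q ∸ p) * d + p * d ≡ q * d
      complement {p} {q} p≤q = trans (sym (ℕₚ.*-distribʳ-+ d (q ∸ p) p)) (cong (_* d) (ℕₚ.m∸n+n≡m p≤q))

      decompose : ∀ x → x ≡ x % d + x / d * d
      decompose x = m≡m%n+[m/n]*n x d

    -- An r < d in C would be represented both as r + 0 and as 0 + r.
    block-zero : Block 0
    block-zero .C-start r<d c = proj₁ (unique (initial r<d) 0∈C 0∈A c refl)
    block-zero .A-fill  r<d _ = initial (subst (_< d) (sym (+-identityʳ _)) r<d)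
    block-zero .A-start _   _ = 0∈A

    private
      -- Write d = x + y. If y = 0 then d would lie in A, and 0 < y < d is excluded by block 0;
      -- hence y = d.
      d∈C : d < N → C d
      d∈C d<N with covers d<N
      ... | x , zero  , a , c , eq = contradiction (subst A (trans (sym (+-identityʳ x)) eq) a) d∉A
      ... | x , suc y , a , c , eq with suc y ℕ.<? d
      ...   | yes y<d = contradiction (block-zero .C-start y<d (subst C (sym (+-identityʳ (suc y))) c)) λ()
      ...   | no y≮d  = subst C (ℕₚ.≤-antisym (≤-trans (ℕₚ.m≤n+m (suc y) x) (≤-reflexive eq)) (ℕₚ.≮⇒≥ y≮d)) c

      module Step (q′ : ℕ) (prev : ∀ {p} → p < suc q′ → Block p) (qd<N : suc q′ * d < N) where
        q : ℕ
        q = suc q′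

        covered-by-zero : A (q * d) → Block q
        covered-by-zero qd∈A = record { C-start = C-start′ ; A-fill = λ r<d _ → A-fill′ r<d ; A-start = λ _ _ → qd∈A }
          where
          d≤qd : d ≤ q * d
          d≤qd = ℕₚ.m≤m+n d (q′ * d)
          -- For r > 0, the number q d + d is also (d - r) + (r + q d), and d - r < d ≤ q d
          -- contradicts uniqueness.
          C-start′ : ∀ {r} → r < d → C (r + q * d) → r ≡ 0
          C-start′ {zero}  _   _ = refl
          C-start′ {suc r} r<d c = contradiction
            (proj₁ (unique (initial (s≤s (ℕₚ.m∸n≤m d′ r))) c qd∈A (d∈C (ℕₚ.≤-<-trans d≤qd qd<N)) sum-eq))
            (ℕₚ.<⇒≢ (ℕₚ.<-≤-trans (s≤s (ℕₚ.m∸n≤m d′ r)) d≤qd))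
            where
            sum-eq : (d ∸ suc r) + (suc r + q * d) ≡ q * d + d
            sum-eq = trans (sym (+-assoc (d ∸ suc r) (suc r) (q * d)))
              (trans (cong (_+ q * d) (ℕₚ.m∸n+n≡m (<⇒≤ r<d))) (+-comm d (q * d)))
          -- As q d + d < N, the number r + q d has a representation x + y. If y > 0, then y = p d
          -- with 0 < p ≤ q and x = r + (q - p) d lies in an earlier block, so (q - p) d ∈ A. Now (q
          -- - p) d + p d and q d + 0 represent the same number, which forces y = 0.
          A-fill′ : ∀ {r} → r < d → A (r + q * d)
          A-fill′ {r} r<d with covers (ℕₚ.≤-<-trans
              (ℕₚ.+-monoˡ-≤ (q * d) (<⇒≤ r<d))
              (subst (_< N) (+-comm (q * d) d) (bounded qd∈A (d∈C (ℕₚ.≤-<-trans d≤qd qd<N)))))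
          ... | x , zero , a , c , eq = subst A (trans (sym (+-identityʳ x)) eq) a
          ... | x , y@(suc _) , a , c , eq = contradiction y≡0 λ()
            where
            p s : ℕ
            p = y / d
            s = y % d
            y≤ : y ≤ r + q * d
            y≤ = ≤-trans (ℕₚ.m≤n+m y x) (≤-reflexive eq)
            p≤q : p ≤ q
            p≤q = ℕₚ.≤-pred (m<n*o⇒m/o<n {n = suc q} (ℕₚ.≤-<-trans y≤ (ℕₚ.+-monoˡ-< (q * d) r<d)))
            y≡ : y ≡ p * d
            y≡ with p ℕ.≟ q
            ... | yes p≡q = trans (decompose y) (cong (_+ p * d)
                    (C-start′ (m%n<n y d) (subst C (trans (decompose y) (cong (λ z → s + z * d) p≡q)) c)))
            ... | no p≢q  = trans (decompose y) (cong (_+ p * d)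
                    (prev (ℕₚ.≤∧≢⇒< p≤q p≢q) .C-start (m%n<n y d) (subst C (decompose y) c)))
            p≢0 : p ≢ 0
            p≢0 p≡0 = contradiction (trans y≡ (cong (_* d) p≡0)) λ()
            x≡ : x ≡ r + (q ∸ p) * d
            x≡ = ℕₚ.+-cancelʳ-≡ (p * d) x (r + (q ∸ p) * d) (trans (cong (_+_ x) (sym y≡)) (trans eq (sym
              (trans (+-assoc r ((q ∸ p) * d) (p * d)) (cong (_+_ r) (complement p≤q))))))
            q∸p<q : q ∸ p < q
            q∸p<q = ℕₚ.∸-monoʳ-< (ℕₚ.n≢0⇒n>0 p≢0) p≤q
            y≡0 : y ≡ 0
            y≡0 = proj₂ (unique (prev q∸p<q .A-start r<d (subst A x≡ a)) c qd∈A 0∈C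
              (trans (cong (_+_ ((q ∸ p) * d)) y≡) (trans (complement p≤q) (sym (+-identityʳ (q * d))))))

        -- Here q d = x + y with x = (q − p) d and 0 < y = p d, so the whole block q is y + (block q − p) ⊂ y + A.
        covered-by-nonzero : ∀ {x y} → A x → C y → x + y ≡ q * d → y ≢ 0 → Block q
        covered-by-nonzero {x} {y} a c eq y≢0 = record
          { C-start = λ {r} r<d c′ → ℕₚ.m+n≡0⇒m≡0 r (sym (proj₁ (unique 0∈A c′ (shifted r<d) c (sym (shift-sum r)))))
          ; A-fill  = λ {r} r<d a′ → contradiction (clash a′ z<d refl) y≢0
          ; A-start = λ {r} r<d a′ → contradiction (clash a′ r<d refl) y≢0
          }
          where
          z<d : 0 < d
          z<d = s≤s z≤n
          p : ℕ
          p = y / d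
          y≤ : y ≤ q * d
          y≤ = ≤-trans (ℕₚ.m≤n+m y x) (≤-reflexive eq)
          p≤q : p ≤ q
          p≤q = ℕₚ.≤-pred (m<n*o⇒m/o<n {n = suc q} (ℕₚ.≤-<-trans y≤ (ℕₚ.+-monoˡ-< (q * d) z<d)))
          y≡ : y ≡ p * d
          y≡ with p ℕ.≟ q
          ... | yes p≡q = ℕₚ.≤-antisym (≤-trans y≤ (≤-reflexive (cong (_* d) (sym p≡q)))) (m/n*n≤m y d)
          ... | no p≢q  = trans (decompose y) (cong (_+ p * d)
                  (prev (ℕₚ.≤∧≢⇒< p≤q p≢q) .C-start (m%n<n y d) (subst C (decompose y) c)))
          p≢0 : p ≢ 0
          p≢0 p≡0 = y≢0 (trans y≡ (cong (_* d) p≡0))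
          total : (q ∸ p) * d + y ≡ q * d
          total = trans (cong (_+_ ((q ∸ p) * d)) y≡) (complement p≤q)
          x≡ : x ≡ (q ∸ p) * d
          x≡ = ℕₚ.+-cancelʳ-≡ y x ((q ∸ p) * d) (trans eq (sym total))
          shifted : ∀ {r} → r < d → A (r + (q ∸ p) * d)
          shifted r<d = prev (ℕₚ.∸-monoʳ-< (ℕₚ.n≢0⇒n>0 p≢0) p≤q) .A-fill r<d (subst A x≡ a)
          shift-sum : ∀ r → (r + (q ∸ p) * d) + y ≡ r + q * d
          shift-sum r = trans (+-assoc r ((q ∸ p) * d) y) (cong (_+_ r) total)
          -- An element r + q d of A is also (r + (q - p) d) + y, and uniqueness forces y = 0. Since
          -- y ≠ 0, block q is disjoint from A.
          clash : ∀ {r n} → A n → r < d → n ≡ r + q * d → y ≡ 0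
          clash {r} a′ r<d refl = proj₂ (unique (shifted r<d) c a′ 0∈C (trans (shift-sum r) (sym (+-identityʳ (r + q * d)))))

        step : Block q
        step with covers qd<N
        ... | x , zero , a , c , eq = covered-by-zero (subst A (trans (sym (+-identityʳ x)) eq) a)
        ... | x , suc y , a , c , eq = covered-by-nonzero a c eq λ()

    block : ∀ q → Block q
    block = <-rec Block go
      where
      go : ∀ q → (∀ {p} → p < q → Block p) → Block q
      go zero     _    = block-zero
      go (suc q′) prev with suc q′ * d ℕ.<? N
      ... | yes qd<N = Step.step q′ prev qd<N
      ... | no qd≮N = record
        { C-start = λ {r} _ c → contradiction (ℕₚ.≤-<-trans (ℕₚ.m≤n+m _ r) (bounded 0∈A c)) qd≮N
        ; A-fill  = λ _ a → contradiction (A<N a) qd≮N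
        ; A-start = λ {r} _ a → contradiction (ℕₚ.≤-<-trans (ℕₚ.m≤n+m _ r) (A<N a)) qd≮N
        }

    d∣C : ∀ {x} → C x → d ∣ x
    d∣C {x} c = divides (x / d) (trans (decompose x)
      (cong (_+ x / d * d) (block (x / d) .C-start (m%n<n x d) (subst C (decompose x) c))))

    A⇒floor : ∀ {x} → A x → A (x / d * d)
    A⇒floor {x} a = block (x / d) .A-start (m%n<n x d) (subst A (decompose x) a)

    floor⇒A : ∀ {x} → A (x / d * d) → A x
    floor⇒A {x} a = subst A (sym (decompose x)) (block (x / d) .A-fill (m%n<n x d) a)

    -- If N were not a multiple of d, the start of the last, incomplete block would be x + y with y
    -- ∈ C. Since d divides y, it divides x, so A contains x + d - 1 as well, and (x + d - 1) + y <
    -- N makes that block complete.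
    d∣N : d ∣ N
    d∣N with N % d ℕ.≟ 0
    ... | yes r≡0 = divides (N / d) (trans (decompose N) (cong (_+ N / d * d) r≡0))
    ... | no r≢0 with covers (subst (N / d * d <_) (sym (decompose N)) (ℕₚ.m<n+m (N / d * d) (ℕₚ.n≢0⇒n>0 r≢0)))
    ...   | x , y , a , c , eq = contradiction d≤N%d (ℕₚ.<⇒≱ (m%n<n N d))
      where
      d∣x : d ∣ x
      d∣x = ∣m+n∣m⇒∣n {m = y} (divides (N / d) (trans (+-comm y x) eq)) (d∣C c)
      x≡ : x ≡ x / d * d
      x≡ = sym (m/n*n≡m d∣x)
      filled : A (d′ + x)
      filled = subst (λ z → A (d′ + z)) (sym x≡) (block (x / d) .A-fill ≤-refl (subst A x≡ a))
      d≤N%d : d ≤ N % d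
      d≤N%d = ℕₚ.+-cancelʳ-≤ (N / d * d) d (N % d) (≤-trans
        (≤-reflexive (cong suc (trans (cong (_+_ d′) (sym eq)) (sym (+-assoc d′ x y)))))
        (≤-trans (bounded filled c) (≤-reflexive (decompose N))))

  -- Division with remainder and sums of tuples.

  divMod-unique : ∀ d .{{_ : NonZero d}} {r r′} q q′ → r < d → r′ < d → r + q * d ≡ r′ + q′ * d → r ≡ r′ × q ≡ q′
  divMod-unique d {r} {r′} q q′ r<d r′<d eq =
    r≡ , ℕₚ.*-cancelʳ-≡ q q′ d (ℕₚ.+-cancelˡ-≡ r (q * d) (q′ * d) (trans eq (cong (_+ q′ * d) (sym r≡))))
    where
    r≡ : r ≡ r′
    r≡ = begin
      r                 ≡⟨ m<n⇒m%n≡m r<d ⟨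
      r % d             ≡⟨ [m+kn]%n≡m%n r q d ⟨
      (r + q * d) % d   ≡⟨ cong (_% d) eq ⟩
      (r′ + q′ * d) % d ≡⟨ [m+kn]%n≡m%n r′ q′ d ⟩
      r′ % d            ≡⟨ m<n⇒m%n≡m r′<d ⟩
      r′                ∎
      where open ≡-Reasoning

  [r+qd]/d : ∀ d .{{_ : NonZero d}} {r} q → r < d → (r + q * d) / d ≡ q
  [r+qd]/d d {r} q r<d =
    sym (proj₂ (divMod-unique d q ((r + q * d) / d) r<d (m%n<n (r + q * d) d) (m≡m%n+[m/n]*n (r + q * d) d)))

  punchIn-elim : ∀ {m} (P : Fin (suc m) → Set) j → P j → (∀ i → P (punchIn j i)) → ∀ i → P i
  punchIn-elim P j pj rest i with j Fin.≟ i
  ... | yes refl = pj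
  ... | no j≢i   = subst P (punchIn-punchOut j≢i) (rest (punchOut j≢i))

  sum≡0 : ∀ {m} (a : Fin m → ℕ) → sum a ≡ 0 → ∀ i → a i ≡ 0
  sum≡0 a eq zero    = ℕₚ.m+n≡0⇒m≡0 (a zero) eq
  sum≡0 a eq (suc i) = sum≡0 (a ∘ suc) (ℕₚ.m+n≡0⇒n≡0 (a zero) eq) i

  sum-*ʳ : ∀ {m} (a : Fin m → ℕ) d → sum (λ i → a i * d) ≡ sum a * d
  sum-*ʳ a d = sym (*-distribʳ-sum d a)

  sum-insertAt : ∀ {m} (c : Fin m → ℕ) j x → sum (insertAt c j x) ≡ x + sum c
  sum-insertAt c j x = trans (sum-remove {i = j} (insertAt c j x))
    (cong₂ _+_ (insertAt-at c j x) (sum-cong-≗ (insertAt-off c j x)))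

  module _ (d : ℕ) .{{_ : NonZero d}} where

    sum-exact : ∀ {m} (a : Fin m → ℕ) → (∀ i → d ∣ a i) → sum a ≡ sum (λ i → a i / d) * d
    sum-exact a div = trans (sum-cong-≗ (λ i → sym (m/n*n≡m (div i)))) (sum-*ʳ (λ i → a i / d) d)

    -- Only the j-th summand carries a remainder, so taking quotients by d commutes with summation.
    sum-divMod : ∀ {m} (a : Fin (suc m) → ℕ) j → (∀ i → d ∣ a (punchIn j i)) →
      sum a ≡ a j % d + sum (λ i → a i / d) * d
    sum-divMod a j div = begin
      sum a                                                           ≡⟨ sum-remove {i = j} a ⟩
      a j + sum (a ∘ punchIn j)
        ≡⟨ cong₂ _+_ (m≡m%n+[m/n]*n (a j) d) (sum-exact (a ∘ punchIn j) div) ⟩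
      (a j % d + a j / d * d) + sum (λ i → a (punchIn j i) / d) * d   ≡⟨ +-assoc (a j % d) (a j / d * d) _ ⟩
      a j % d + (a j / d * d + sum (λ i → a (punchIn j i) / d) * d)   ≡⟨ cong (_+_ (a j % d)) (*-distribʳ-+ d (a j / d) _) ⟨
      a j % d + (a j / d + sum (λ i → a (punchIn j i) / d)) * d       ≡⟨ cong (λ z → a j % d + z * d) (sum-remove {i = j} (λ i → a i / d)) ⟨
      a j % d + sum (λ i → a i / d) * d                               ∎
      where open ≡-Reasoning

  -- Sum systems as families of predicates.

  Family : ℕ → Set₁
  Family m = Fin m → ℕ → Set

  Member : ∀ {m} → Family m → (Fin m → ℕ) → Set
  Member s a = ∀ i → s i (a i)

  -- Predicates on ℕ carry no range, so rescaling by d need not change their type. Unique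
  -- representation takes the place of the condition on the cardinalities, being the form in which
  -- the decomposition uses it.
  record SumSystem {m} (N : ℕ) (s : Family m) : Set where
    field
      bounded : ∀ a → Member s a → sum a < N
      covers  : ∀ n → n < N → ∃ λ a → Member s a × sum a ≡ n
      unique  : ∀ a b → Member s a → Member s b → sum a ≡ sum b → a ≗ b

  SumSystem-resp : ∀ {m N} {s t : Family m} → (∀ i x → s i x → t i x) → (∀ i x → t i x → s i x) →
    SumSystem N s → SumSystem N t
  SumSystem-resp s⇒t t⇒s sys = record
    { bounded = λ a a∈ → bounded a (λ i → t⇒s i _ (a∈ i))
    ; covers  = λ n n<N → let (a , a∈ , eq) = covers n n<N in a , (λ i → s⇒t i _ (a∈ i)) , eq
    ; unique  = λ a b a∈ b∈ → unique a b (λ i → t⇒s i _ (a∈ i)) (λ i → t⇒s i _ (b∈ i))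
    }
    where open SumSystem sys

  0∈parts : ∀ {m N} {s : Family m} → 1 ≤ N → SumSystem N s → ∀ i → s i 0
  0∈parts {s = s} 1≤N sys i with SumSystem.covers sys 0 1≤N
  ... | a , a∈ , eq = subst (s i) (sum≡0 a eq i) (a∈ i)

  single : ∀ {m} → Fin m → ℕ → Fin m → ℕ
  single zero    x zero    = x
  single zero    x (suc _) = 0
  single (suc i) x zero    = 0
  single (suc i) x (suc k) = single i x k

  sum-single : ∀ {m} (i : Fin m) x → sum (single i x) ≡ x
  sum-single {suc m} zero    x = trans (cong (_+_ x) (sum-replicate-zero m)) (+-identityʳ x)
  sum-single         (suc i) x = sum-single i x

  Member-single : ∀ {m} (s : Family m) → (∀ i → s i 0) → ∀ i x → s i x → Member s (single i x)
  Member-single s 0∈ zero    x x∈ zero    = x∈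
  Member-single s 0∈ zero    x x∈ (suc k) = 0∈ (suc k)
  Member-single s 0∈ (suc i) x x∈ zero    = 0∈ zero
  Member-single s 0∈ (suc i) x x∈ (suc k) = Member-single (s ∘ suc) (0∈ ∘ suc) i x x∈ k

  Member-insertAt : ∀ {m} (s : Family (suc m)) j x (c : Fin m → ℕ) → s j x → Member (s ∘ punchIn j) c →
    Member s (insertAt c j x)
  Member-insertAt s j x c x∈ c∈ = punchIn-elim (λ i → s i (insertAt c j x i)) j
    (subst (s j) (sym (insertAt-at c j x)) x∈)
    (λ i → subst (s (punchIn j i)) (sym (insertAt-off c j x i)) (c∈ i))

  -- This is the summand C to which `DirectSum` is applied, with A the part j.
  SumOfOthers : ∀ {m} → Family (suc m) → Fin (suc m) → ℕ → Set
  SumOfOthers s j y = ∃ λ c → Member (s ∘ punchIn j) c × sum c ≡ y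

  module Split {m N : ℕ} {s : Family (suc m)} (1≤N : 1 ≤ N) (sys : SumSystem N s) (j : Fin (suc m)) where
    open SumSystem sys

    split-bounded : ∀ {x y} → s j x → SumOfOthers s j y → x + y < N
    split-bounded {x} x∈ (c , c∈ , refl) = subst (_< N) (sum-insertAt c j x) (bounded _ (Member-insertAt s j x c x∈ c∈))

    split-covers : ∀ {n} → n < N → ∃ λ x → ∃ λ y → s j x × SumOfOthers s j y × x + y ≡ n
    split-covers n<N with covers _ n<N
    ... | a , a∈ , eq = a j , sum (a ∘ punchIn j) , a∈ j , (a ∘ punchIn j , a∈ ∘ punchIn j , refl) ,
                        trans (sym (sum-remove {i = j} a)) eq

    split-unique : ∀ {x y x′ y′} → s j x → SumOfOthers s j y → s j x′ → SumOfOthers s j y′ →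
      x + y ≡ x′ + y′ → x ≡ x′ × y ≡ y′
    split-unique {x} {y} {x′} x∈ (c , c∈ , refl) x′∈ (c′ , c′∈ , refl) eq =
      x≡x′ , ℕₚ.+-cancelˡ-≡ x _ _ (trans eq (cong (_+ sum c′) (sym x≡x′)))
      where
      x≡x′ : x ≡ x′
      x≡x′ = begin
        x                    ≡⟨ insertAt-at c j x ⟨
        insertAt c j x j     ≡⟨ unique (insertAt c j x) (insertAt c′ j x′)
                                  (Member-insertAt s j x c x∈ c∈) (Member-insertAt s j x′ c′ x′∈ c′∈)
                                  (trans (sum-insertAt c j x) (trans eq (sym (sum-insertAt c′ j x′)))) j ⟩
        insertAt c′ j x′ j   ≡⟨ insertAt-at c′ j x′ ⟩
        x′                   ∎
        where open ≡-Reasoning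

    0∈others : SumOfOthers s j 0
    0∈others = (λ _ → 0) , (λ i → 0∈parts 1≤N sys (punchIn j i)) , sum-replicate-zero m

    module Leading (d′ : ℕ) (initial : ∀ {x} → x < suc d′ → s j x) (d∉ : ¬ s j (suc d′)) where

      open DirectSum {A = s j} {C = SumOfOthers s j} split-bounded split-covers split-unique
        (0∈parts 1≤N sys j) 0∈others d′ initial d∉ public

      -- Every other part contains 0, so each element of one of them is itself a sum in C.
      d∣others : ∀ i {x} → s (punchIn j i) x → suc d′ ∣ x
      d∣others i {x} x∈ = d∣C
        (single i x , Member-single (s ∘ punchIn j) (0∈parts 1≤N sys ∘ punchIn j) i x x∈ , sum-single i x)

  -- Rescaling a sum system and removing a part {0}.

  deflate : ∀ {m} → ℕ → Family m → Family m
  deflate d s i x = s i (x * d)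

  -- The condition on x / d alone describes {0,...,d-1} + d s_i; the divisibility clause cuts this
  -- down to d s_i for i ≠ j.
  inflate : ∀ {m} → Fin m → (d : ℕ) .{{_ : NonZero d}} → Family m → Family m
  inflate j d s i x = s i (x / d) × (i ≢ j → d ∣ x)

  module _ (d : ℕ) .{{_ : NonZero d}} {m N : ℕ} {s : Family (suc m)} (j : Fin (suc m)) where

    deflate-SumSystem : (∀ i {x} → s (punchIn j i) x → d ∣ x) → (∀ {x} → s j x → s j (x / d * d)) →
      SumSystem (N * d) s → SumSystem N (deflate d s)
    deflate-SumSystem div floor sys = record
      { bounded = λ a a∈ → ℕₚ.*-cancelʳ-< d (sum a) N (subst (_< N * d) (sum-*ʳ a d) (bounded _ a∈))
      ; covers  = covers′
      ; unique  = λ a b a∈ b∈ eq i → ℕₚ.*-cancelʳ-≡ (a i) (b i) d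
          (unique _ _ a∈ b∈ (trans (sum-*ʳ a d) (trans (cong (_* d) eq) (sym (sum-*ʳ b d)))) i)
      }
      where
      open SumSystem sys
      covers′ : ∀ n → n < N → ∃ λ a → Member (deflate d s) a × sum a ≡ n
      covers′ n n<N with covers (n * d) (ℕₚ.*-monoˡ-< d n<N)
      ... | a , a∈ , eq = (λ i → a i / d) ,
        punchIn-elim (λ i → s i (a i / d * d)) j (floor (a∈ j))
          (λ i → subst (s (punchIn j i)) (sym (m/n*n≡m (div i (a∈ (punchIn j i))))) (a∈ (punchIn j i))) ,
        -- The target n d has remainder 0, so comparing quotients shows that the a_i / d sum to n.
        proj₂ (divMod-unique d _ n (m%n<n (a j) d) (ℕ.>-nonZero⁻¹ d)
          (trans (sym (sum-divMod d a j (λ i → div i (a∈ (punchIn j i))))) eq))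

    inflate-SumSystem : SumSystem N s → SumSystem (N * d) (inflate j d s)
    inflate-SumSystem sys = record { bounded = bounded′ ; covers = covers′ ; unique = unique′ }
      where
      open SumSystem sys
      div : ∀ {a} → Member (inflate j d s) a → ∀ i → d ∣ a (punchIn j i)
      div a∈ i = proj₂ (a∈ (punchIn j i)) (punchInᵢ≢i j i)
      bounded′ : ∀ a → Member (inflate j d s) a → sum a < N * d
      bounded′ a a∈ = subst (_< N * d) (sym (sum-divMod d a j (div a∈)))
        (ℕₚ.<-≤-trans (ℕₚ.+-monoˡ-< _ (m%n<n (a j) d)) (ℕₚ.*-monoˡ-≤ d (bounded (λ i → a i / d) (proj₁ ∘ a∈))))
      covers′ : ∀ n → n < N * d → ∃ λ a → Member (inflate j d s) a × sum a ≡ n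
      covers′ n n<Nd with covers (n / d) (m<n*o⇒m/o<n {n = N} n<Nd)
      -- Part j absorbs the remainder n % d, while the given system represents the quotient n / d.
      ... | b , b∈ , eq = insertAt (λ i → b (punchIn j i) * d) j (n % d + b j * d) ,
        Member-insertAt (inflate j d s) j _ _
          (subst (s j) (sym ([r+qd]/d d (b j) (m%n<n n d))) (b∈ j) , λ j≢j → contradiction refl j≢j)
          (λ i → subst (s (punchIn j i)) (sym (m*n/n≡m _ d)) (b∈ (punchIn j i)) , λ _ → n∣m*n (b (punchIn j i))) ,
        (begin
          sum (insertAt (λ i → b (punchIn j i) * d) j (n % d + b j * d)) ≡⟨ sum-insertAt _ j _ ⟩
          (n % d + b j * d) + sum (λ i → b (punchIn j i) * d)            ≡⟨ +-assoc (n % d) (b j * d) _ ⟩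
          n % d + (b j * d + sum (λ i → b (punchIn j i) * d))            ≡⟨ cong (_+_ (n % d)) (sum-remove {i = j} (λ i → b i * d)) ⟨
          n % d + sum (λ i → b i * d)                                    ≡⟨ cong (_+_ (n % d)) (trans (sum-*ʳ b d) (cong (_* d) eq)) ⟩
          n % d + n / d * d                                              ≡⟨ m≡m%n+[m/n]*n n d ⟨
          n                                                              ∎)
        where open ≡-Reasoning
      unique′ : ∀ a b → Member (inflate j d s) a → Member (inflate j d s) b → sum a ≡ sum b → a ≗ b
      unique′ a b a∈ b∈ eq = punchIn-elim (λ i → a i ≡ b i) j
        (trans (m≡m%n+[m/n]*n (a j) d) (trans
          (cong₂ (λ r q → r + q * d) (proj₁ parts) (quotients j)) (sym (m≡m%n+[m/n]*n (b j) d))))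
        (λ i → trans (sym (m/n*n≡m (div a∈ i))) (trans (cong (_* d) (quotients (punchIn j i))) (m/n*n≡m (div b∈ i))))
        where
        parts : a j % d ≡ b j % d × sum (λ i → a i / d) ≡ sum (λ i → b i / d)
        parts = divMod-unique d _ _ (m%n<n (a j) d) (m%n<n (b j) d)
          (trans (sym (sum-divMod d a j (div a∈))) (trans eq (sum-divMod d b j (div b∈))))
        quotients : ∀ i → a i / d ≡ b i / d
        quotients = unique _ _ (proj₁ ∘ a∈) (proj₁ ∘ b∈) (proj₂ parts)

  module _ {m N : ℕ} {s : Family (suc m)} (j : Fin (suc m)) (0∈ : s j 0) (only0 : ∀ {x} → s j x → x ≡ 0) where

    private
      sum-others : ∀ a → Member s a → sum a ≡ sum (a ∘ punchIn j)
      sum-others a a∈ = trans (sum-remove {i = j} a) (cong (_+ sum (a ∘ punchIn j)) (only0 (a∈ j)))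

    removeTrivial : SumSystem N s → SumSystem N (s ∘ punchIn j)
    removeTrivial sys = record
      { bounded = λ c c∈ → subst (_< N) (sum-insertAt c j 0) (bounded _ (Member-insertAt s j 0 c 0∈ c∈))
      ; covers  = λ n n<N → let (a , a∈ , eq) = covers n n<N in
          a ∘ punchIn j , a∈ ∘ punchIn j , trans (sym (sum-others a a∈)) eq
      ; unique  = λ c c′ c∈ c′∈ eq i → trans (sym (insertAt-off c j 0 i)) (trans
          (unique (insertAt c j 0) (insertAt c′ j 0) (Member-insertAt s j 0 c 0∈ c∈) (Member-insertAt s j 0 c′ 0∈ c′∈)
            (trans (sum-insertAt c j 0) (trans eq (sym (sum-insertAt c′ j 0)))) (punchIn j i))
          (insertAt-off c′ j 0 i))
      }
      where open SumSystem sys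

    insertTrivial : SumSystem N (s ∘ punchIn j) → SumSystem N s
    insertTrivial sys = record
      { bounded = λ a a∈ → subst (_< N) (sym (sum-others a a∈)) (bounded _ (a∈ ∘ punchIn j))
      ; covers  = λ n n<N → let (c , c∈ , eq) = covers n n<N in
          insertAt c j 0 , Member-insertAt s j 0 c 0∈ c∈ , trans (sum-insertAt c j 0) eq
      ; unique  = λ a b a∈ b∈ eq → punchIn-elim (λ i → a i ≡ b i) j
          (trans (only0 (a∈ j)) (sym (only0 (b∈ j))))
          (unique _ _ (a∈ ∘ punchIn j) (b∈ ∘ punchIn j) (trans (sym (sum-others a a∈)) (trans eq (sum-others b b∈))))
      }
      where open SumSystem sys

  -- Counting with duplicate-free lists.

  module _ {A : Set} where

    ∈-skip : ∀ {x y : A} us {ws} → x ∈ˡ us ++ y ∷ ws → x ≢ y → x ∈ˡ us ++ ws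
    ∈-skip us x∈ x≢y with ∈-++⁻ us x∈
    ... | inj₁ x∈us          = ∈-++⁺ˡ x∈us
    ... | inj₂ (here x≡y)    = contradiction x≡y x≢y
    ... | inj₂ (there x∈ws)  = ∈-++⁺ʳ us x∈ws

    unique-⊆⇒length≤ : ∀ {xs ys : List A} → Unique xs → (∀ {x} → x ∈ˡ xs → x ∈ˡ ys) → length xs ≤ length ys
    unique-⊆⇒length≤ {[]} _ _ = z≤n
    unique-⊆⇒length≤ {x ∷ xs} {ys} (x∉ ∷ xs!) ⊆ with ∈-∃++ (⊆ (here refl))
    ... | us , ws , refl = ≤-trans
      (s≤s (unique-⊆⇒length≤ xs! (λ y∈ → ∈-skip us (⊆ (there y∈)) (λ y≡x → All.lookup x∉ y∈ (sym y≡x)))))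
      (≤-reflexive (sym (length-++-sucʳ us x ws)))

    unique-⇔⇒length≡ : ∀ {xs ys : List A} → Unique xs → Unique ys →
      (∀ {x} → x ∈ˡ xs → x ∈ˡ ys) → (∀ {x} → x ∈ˡ ys → x ∈ˡ xs) → length xs ≡ length ys
    unique-⇔⇒length≡ xs! ys! ⊆ ⊇ = ℕₚ.≤-antisym (unique-⊆⇒length≤ xs! ⊆) (unique-⊆⇒length≤ ys! ⊇)

    unique-map : ∀ {B : Set} (f : A → B) {xs} → (∀ {x y} → x ∈ˡ xs → y ∈ˡ xs → f x ≡ f y → x ≡ y) →
      Unique xs → Unique (List.map f xs)
    unique-map f {[]} inj [] = []
    unique-map f {x ∷ xs} inj (x∉ ∷ xs!) =
      All.tabulate fresh ∷ unique-map f (λ x∈ y∈ → inj (there x∈) (there y∈)) xs!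
      where
      fresh : ∀ {z} → z ∈ˡ List.map f xs → f x ≢ z
      fresh z∈ fx≡z with ∈-map⁻ f z∈
      ... | y , y∈ , refl = All.lookup x∉ y∈ (inj (here refl) (there y∈) fx≡z)

  -- If x ≠ y had the same image, deleting x would leave N - 1 entries that still cover N values.
  -- The conclusion is doubly negated because equality on `A` need not be decidable.
  onto⇒injective : ∀ {A : Set} (f : A → ℕ) {xs N} → length xs ≡ N → (∀ {n} → n < N → n ∈ˡ List.map f xs) →
    ∀ {x y} → x ∈ˡ xs → y ∈ˡ xs → f x ≡ f y → ¬ x ≢ y
  onto⇒injective f {N = N} len onto {x} {y} x∈ y∈ fx≡fy x≢y with ∈-∃++ x∈
  ... | us , ws , refl = ℕₚ.<-irrefl refl (begin-strict
    N                                  ≡⟨ length-upTo N ⟨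
    length (upTo N)                    ≤⟨ unique-⊆⇒length≤ (Unique.upTo⁺ N) (still-onto ∘ ∈-upTo⁻) ⟩
    length (List.map f (us ++ ws))     ≡⟨ length-map f (us ++ ws) ⟩
    length (us ++ ws)                  <⟨ ≤-refl ⟩
    suc (length (us ++ ws))            ≡⟨ length-++-sucʳ us x ws ⟨
    length (us ++ x ∷ ws)              ≡⟨ len ⟩
    N                                  ∎)
    where
    open ℕₚ.≤-Reasoning
    still-onto : ∀ {n} → n < N → n ∈ˡ List.map f (us ++ ws)
    still-onto n<N with ∈-map⁻ f (onto n<N)
    ... | z , z∈ , refl with ∈-++⁻ us z∈
    ...   | inj₁ z∈us         = ∈-map⁺ f (∈-++⁺ˡ z∈us)
    ...   | inj₂ (there z∈ws) = ∈-map⁺ f (∈-++⁺ʳ us z∈ws)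
    ...   | inj₂ (here refl)  = subst (_∈ˡ List.map f (us ++ ws)) (sym fx≡fy) (∈-map⁺ f (∈-skip us y∈ (x≢y ∘ sym)))

  -- Subsets of {0,...,N-1} as predicates on ℕ.

  mem : ∀ {N} → Subset N → ℕ → Bool
  mem []      _       = false
  mem (b ∷ B) zero    = b
  mem (b ∷ B) (suc x) = mem B x

  mem-subst : ∀ {N} {B C : Subset N} {x} → B ≡ C → mem B x ≡ true → mem C x ≡ true
  mem-subst {x = x} = subst (λ B → mem B x ≡ true)

  mem-< : ∀ {N} (B : Subset N) {x} → mem B x ≡ true → x < N
  mem-< (b ∷ B) {zero}  _ = s≤s z≤n
  mem-< (b ∷ B) {suc x} p = s≤s (mem-< B p)

  lookup-mem : ∀ {N} (B : Subset N) i → lookup B i ≡ mem B (toℕ i)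
  lookup-mem (b ∷ B) zero    = refl
  lookup-mem (b ∷ B) (suc i) = lookup-mem B i

  ∈⇒mem : ∀ {N} {B : Subset N} {i} → i ∈ B → mem B (toℕ i) ≡ true
  ∈⇒mem {B = B} {i} i∈ = trans (sym (lookup-mem B i)) ([]=⇒lookup i∈)

  mem⇒∈ : ∀ {N} {B : Subset N} {i} → mem B (toℕ i) ≡ true → i ∈ B
  mem⇒∈ {B = B} {i} p = lookup⇒[]= i B (trans (lookup-mem B i) p)

  mem-ext : ∀ {N} {B C : Subset N} →
    (∀ x → mem B x ≡ true → mem C x ≡ true) → (∀ x → mem C x ≡ true → mem B x ≡ true) → B ≡ C
  mem-ext {B = []}    {[]}    _ _ = refl
  mem-ext {B = b ∷ B} {c ∷ C} f g = cong₂ _∷_ (bool b c (f 0) (g 0)) (mem-ext (f ∘ suc) (g ∘ suc))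
    where
    bool : ∀ b c → (b ≡ true → c ≡ true) → (c ≡ true → b ≡ true) → b ≡ c
    bool true  c     f g = sym (f refl)
    bool false false f g = refl
    bool false true  f g = g refl

  select : ∀ N {P : ℕ → Set} → (∀ x → Dec (P x)) → Subset N
  select zero    P? = []
  select (suc N) P? = does (P? 0) ∷ select N (P? ∘ suc)

  select⁺ : ∀ N {P : ℕ → Set} (P? : ∀ x → Dec (P x)) {x} → x < N → P x → mem (select N P?) x ≡ true
  select⁺ (suc N) P? {zero}  _         p = dec-true (P? 0) p
  select⁺ (suc N) P? {suc x} (s≤s x<N) p = select⁺ N (P? ∘ suc) x<N p

  select⁻ : ∀ N {P : ℕ → Set} (P? : ∀ x → Dec (P x)) {x} → mem (select N P?) x ≡ true → P x
  select⁻ (suc N) P? {zero}  p with P? 0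
  ... | yes p0 = p0
  select⁻ (suc N) P? {suc x} p = select⁻ N (P? ∘ suc) p

  -- For sets containing 0 this amounts to having at least two elements, and it passes through
  -- rescaling without any counting.
  HasPositive : ∀ {N} → Subset N → Set
  HasPositive B = ∃ λ x → mem B (suc x) ≡ true

  card-positive⇒mem : ∀ {N} (B : Subset N) → 1 ≤ ∣ B ∣ → ∃ λ x → mem B x ≡ true
  card-positive⇒mem (true  ∷ B) _ = 0 , refl
  card-positive⇒mem (false ∷ B) p with card-positive⇒mem B p
  ... | x , x∈ = suc x , x∈

  mem⇒card-positive : ∀ {N} (B : Subset N) x → mem B x ≡ true → 1 ≤ ∣ B ∣
  mem⇒card-positive (true  ∷ B) _       _  = s≤s z≤n
  mem⇒card-positive (false ∷ B) (suc x) x∈ = mem⇒card-positive B x x∈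

  card≥2⇒HasPositive : ∀ {N} (B : Subset N) → mem B 0 ≡ true → 2 ≤ ∣ B ∣ → HasPositive B
  card≥2⇒HasPositive (true ∷ B) _ (s≤s p) = card-positive⇒mem B p

  HasPositive⇒card≥2 : ∀ {N} (B : Subset N) → mem B 0 ≡ true → HasPositive B → 2 ≤ ∣ B ∣
  HasPositive⇒card≥2 (true ∷ B) _ (x , x∈) = s≤s (mem⇒card-positive B x x∈)

  HasPositive? : ∀ {N} (B : Subset N) → mem B 0 ≡ true → Dec (HasPositive B)
  HasPositive? B 0∈ with 2 ℕ.≤? ∣ B ∣
  ... | yes p = yes (card≥2⇒HasPositive B 0∈ p)
  ... | no ¬p = no (¬p ∘ HasPositive⇒card≥2 B 0∈)

  ⟦_⟧ : ∀ {N m} → Vec (Subset N) m → Family m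
  ⟦ A ⟧ i x = mem (lookup A i) x ≡ true

  ⟦⟧? : ∀ {N m} (A : Vec (Subset N) m) i x → Dec (⟦ A ⟧ i x)
  ⟦⟧? A i x = mem (lookup A i) x Bool.≟ true

  lookup-ext : ∀ {X : Set} {m} {v w : Vec X m} → (∀ i → lookup v i ≡ lookup w i) → v ≡ w
  lookup-ext {v = []}    {[]}    _ = refl
  lookup-ext {v = x ∷ v} {y ∷ w} f = cong₂ _∷_ (f zero) (lookup-ext (f ∘ suc))

  ⟦⟧-ext : ∀ {N m} {A B : Vec (Subset N) m} → (∀ i x → ⟦ A ⟧ i x → ⟦ B ⟧ i x) → (∀ i x → ⟦ B ⟧ i x → ⟦ A ⟧ i x) → A ≡ B
  ⟦⟧-ext f g = lookup-ext (λ i → mem-ext (f i) (g i))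

  sum-map-toℕ : ∀ {N m} (v : Vec (Fin N) m) → Vec.sum (Vec.map toℕ v) ≡ sum (toℕ ∘ lookup v)
  sum-map-toℕ []      = refl
  sum-map-toℕ (x ∷ v) = cong (_+_ (toℕ x)) (sum-map-toℕ v)

  module _ {N m : ℕ} (A : Vec (Subset N) m) where

    InSumset⇒ : ∀ {n} → InSumset A n → ∃ λ a → Member ⟦ A ⟧ a × sum a ≡ n
    InSumset⇒ (v , v∈ , eq) = toℕ ∘ lookup v , ∈⇒mem ∘ v∈ , trans (sym (sum-map-toℕ v)) eq

    ⇒InSumset : ∀ {a} → Member ⟦ A ⟧ a → InSumset A (sum a)
    ⇒InSumset {a} a∈ = v , (λ i → mem⇒∈ (subst (λ x → mem (lookup A i) x ≡ true) (sym (value i)) (a∈ i))) ,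
      trans (sum-map-toℕ v) (sum-cong-≗ value)
      where
      v : Vec (Fin N) m
      v = tabulate (λ i → fromℕ< (mem-< (lookup A i) (a∈ i)))
      value : ∀ i → toℕ (lookup v i) ≡ a i
      value i = trans (cong toℕ (lookup∘tabulate _ i)) (toℕ-fromℕ< _)

  -- The cardinality condition and unique representation.

  module Choices where

    elements : ∀ {N} → Subset N → List ℕ
    elements []          = []
    elements (true  ∷ B) = 0 ∷ List.map suc (elements B)
    elements (false ∷ B) = List.map suc (elements B)

    length-elements : ∀ {N} (B : Subset N) → length (elements B) ≡ ∣ B ∣
    length-elements []          = refl
    length-elements (true  ∷ B) = cong suc (trans (length-map suc (elements B)) (length-elements B))
    length-elements (false ∷ B) = trans (length-map suc (elements B)) (length-elements B)

    elements⁺ : ∀ {N} (B : Subset N) {x} → mem B x ≡ true → x ∈ˡ elements B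
    elements⁺ (true  ∷ B) {zero}  _  = here refl
    elements⁺ (true  ∷ B) {suc x} x∈ = there (∈-map⁺ suc (elements⁺ B x∈))
    elements⁺ (false ∷ B) {suc x} x∈ = ∈-map⁺ suc (elements⁺ B x∈)

    elements⁻ : ∀ {N} (B : Subset N) {x} → x ∈ˡ elements B → mem B x ≡ true
    elements⁻ (true  ∷ B) (here refl) = refl
    elements⁻ (true  ∷ B) (there x∈) with ∈-map⁻ suc x∈
    ... | y , y∈ , refl = elements⁻ B y∈
    elements⁻ (false ∷ B) x∈ with ∈-map⁻ suc x∈
    ... | y , y∈ , refl = elements⁻ B y∈

    elements-unique : ∀ {N} (B : Subset N) → Unique (elements B)
    elements-unique []          = []
    elements-unique (true  ∷ B) = All.tabulate fresh ∷ Unique.map⁺ ℕₚ.suc-injective (elements-unique B)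
      where
      fresh : ∀ {z} → z ∈ˡ List.map suc (elements B) → 0 ≢ z
      fresh z∈ refl with ∈-map⁻ suc z∈
      ... | _ , _ , ()
    elements-unique (false ∷ B) = Unique.map⁺ ℕₚ.suc-injective (elements-unique B)

    choices : ∀ {N m} → Vec (Subset N) m → List (Vec ℕ m)
    choices []      = [] ∷ []
    choices (B ∷ A) = cartesianProductWith _∷_ (elements B) (choices A)

    length-cartesianProductWith : ∀ {X Y Z : Set} (f : X → Y → Z) xs ys →
      length (cartesianProductWith f xs ys) ≡ length xs * length ys
    length-cartesianProductWith f []       ys = refl
    length-cartesianProductWith f (x ∷ xs) ys = trans (length-++ (List.map (f x) ys))
      (cong₂ _+_ (length-map (f x) ys) (length-cartesianProductWith f xs ys))

    length-choices : ∀ {N m} (A : Vec (Subset N) m) → length (choices A) ≡ productℕ (Vec.map ∣_∣ A)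
    length-choices []      = refl
    length-choices (B ∷ A) = trans (length-cartesianProductWith _∷_ (elements B) (choices A))
      (cong₂ _*_ (length-elements B) (length-choices A))

    choices⁺ : ∀ {N m} (A : Vec (Subset N) m) {v} → Member ⟦ A ⟧ (lookup v) → v ∈ˡ choices A
    choices⁺ []      {[]}    _  = here refl
    choices⁺ (B ∷ A) {x ∷ v} v∈ = ∈-cartesianProductWith⁺ _∷_ (elements⁺ B (v∈ zero)) (choices⁺ A (v∈ ∘ suc))

    choices⁻ : ∀ {N m} (A : Vec (Subset N) m) {v} → v ∈ˡ choices A → Member ⟦ A ⟧ (lookup v)
    choices⁻ (B ∷ A) {v} v∈ i with ∈-cartesianProductWith⁻ _∷_ (elements B) (choices A) v∈
    choices⁻ (B ∷ A) v∈ zero    | x , w , x∈ , w∈ , refl = elements⁻ B x∈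
    choices⁻ (B ∷ A) v∈ (suc i) | x , w , x∈ , w∈ , refl = choices⁻ A w∈ i

    choices-unique : ∀ {N m} (A : Vec (Subset N) m) → Unique (choices A)
    choices-unique []      = [] ∷ []
    choices-unique (B ∷ A) = Unique.cartesianProductWith⁺ _∷_ ∷-injective (elements-unique B) (choices-unique A)

    module _ {N m : ℕ} (A : Vec (Subset N) m) {a : Fin m → ℕ} (a∈ : Member ⟦ A ⟧ a) where

      tabulate∈choices : tabulate a ∈ˡ choices A
      tabulate∈choices = choices⁺ A (λ i → subst (⟦ A ⟧ i) (sym (lookup∘tabulate a i)) (a∈ i))

      sum∈sums : sum a ∈ˡ List.map (sum ∘ lookup) (choices A)
      sum∈sums = subst (_∈ˡ List.map (sum ∘ lookup) (choices A)) (sum-cong-≗ (lookup∘tabulate a))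
        (∈-map⁺ (sum ∘ lookup) tabulate∈choices)

  open Choices

  -- Since the number of choices (a₁,…,a_m) is ∏|A_j| = N and every n < N is a sum, no n < N is a sum in two ways.
  IsSumSystem⇒SumSystem : ∀ {m N} (A : Vec (Subset N) m) → IsSumSystem m N A → SumSystem N ⟦ A ⟧
  IsSumSystem⇒SumSystem {m} {N} A (card , generates) = record
    { bounded = λ a a∈ → Equivalence.to (generates (sum a)) (⇒InSumset A a∈)
    ; covers  = λ n n<N → InSumset⇒ A (Equivalence.from (generates n) n<N)
    ; unique  = unique′
    }
    where
    onto : ∀ {n} → n < N → n ∈ˡ List.map (sum ∘ lookup) (choices A)
    onto {n} n<N with InSumset⇒ A (Equivalence.from (generates n) n<N)
    ... | a , a∈ , refl = sum∈sums A a∈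
    unique′ : ∀ a b → Member ⟦ A ⟧ a → Member ⟦ A ⟧ b → sum a ≡ sum b → a ≗ b
    unique′ a b a∈ b∈ eq with ≡-dec ℕ._≟_ (tabulate a) (tabulate b)
    ... | yes v≡w = λ i → trans (sym (lookup∘tabulate a i)) (trans (cong (λ v → lookup v i) v≡w) (lookup∘tabulate b i))
    ... | no v≢w  = contradiction v≢w (onto⇒injective (sum ∘ lookup) (trans (length-choices A) card) onto
      (tabulate∈choices A a∈) (tabulate∈choices A b∈)
      (trans (sum-cong-≗ (lookup∘tabulate a)) (trans eq (sym (sum-cong-≗ (lookup∘tabulate b))))))

  -- By uniqueness the sums of all choices are distinct, so they enumerate {0,...,N-1} without
  -- repetition; the number of choices, which is the product of the cardinalities, is therefore N.
  SumSystem⇒IsSumSystem : ∀ {m N} (A : Vec (Subset N) m) → SumSystem N ⟦ A ⟧ → IsSumSystem m N A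
  SumSystem⇒IsSumSystem {m} {N} A sys = card , λ n → mk⇔
    (λ n∈ → let (a , a∈ , eq) = InSumset⇒ A n∈ in subst (_< N) eq (bounded a a∈))
    (λ n<N → let (a , a∈ , eq) = covers n n<N in subst (InSumset A) eq (⇒InSumset A a∈))
    where
    open SumSystem sys
    sums : List ℕ
    sums = List.map (sum ∘ lookup) (choices A)
    sums-unique : Unique sums
    sums-unique = unique-map (sum ∘ lookup)
      (λ v∈ w∈ eq → lookup-ext (unique _ _ (choices⁻ A v∈) (choices⁻ A w∈) eq)) (choices-unique A)
    sums⊆ : ∀ {n} → n ∈ˡ sums → n ∈ˡ upTo N
    sums⊆ n∈ with ∈-map⁻ (sum ∘ lookup) n∈
    ... | v , v∈ , refl = ∈-upTo⁺ (bounded (lookup v) (choices⁻ A v∈))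
    sums⊇ : ∀ {n} → n ∈ˡ upTo N → n ∈ˡ sums
    sums⊇ n∈ with covers _ (∈-upTo⁻ n∈)
    ... | a , a∈ , refl = sum∈sums A a∈
    card : productℕ (Vec.map ∣_∣ A) ≡ N
    card = begin
      productℕ (Vec.map ∣_∣ A) ≡⟨ length-choices A ⟨
      length (choices A)       ≡⟨ length-map (sum ∘ lookup) (choices A) ⟨
      length sums              ≡⟨ unique-⇔⇒length≡ sums-unique (Unique.upTo⁺ N) sums⊆ sums⊇ ⟩
      length (upTo N)          ≡⟨ length-upTo N ⟩
      N                        ∎
      where open ≡-Reasoning

  -- Systems with a distinguished part.

  Proper : ∀ {m N} → Vec (Subset N) m → Set
  Proper {m} {N} A = SumSystem N ⟦ A ⟧ × (∀ i → HasPositive (lookup A i))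

  IsProperSumSystem⇔Proper : ∀ {m N} → 1 ≤ N → (A : Vec (Subset N) m) → IsProperSumSystem m N A ⇔ Proper A
  IsProperSumSystem⇔Proper 1≤N A = mk⇔
    (λ (issys , big) → let sys = IsSumSystem⇒SumSystem A issys in
      sys , λ i → card≥2⇒HasPositive (lookup A i) (0∈parts 1≤N sys i) (big i))
    (λ (sys , pos) → SumSystem⇒IsSumSystem A sys , λ i → HasPositive⇒card≥2 (lookup A i) (0∈parts 1≤N sys i) (pos i))

  least-failure : ∀ {P : ℕ → Set} → (∀ x → Dec (P x)) → ∀ n → ¬ P n → ∃ λ d → d ≤ n × ¬ P d × (∀ {x} → x < d → P x)
  least-failure P? zero    ¬p = 0 , z≤n , ¬p , λ ()
  least-failure {P} P? (suc n) ¬p with P? 0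
  ... | no ¬p0 = 0 , z≤n , ¬p0 , λ ()
  ... | yes p0 with least-failure (P? ∘ suc) n ¬p
  ...   | d , d≤n , ¬pd , below = suc d , s≤s d≤n , ¬pd , λ { {zero} _ → p0 ; {suc x} (s≤s x<d) → below x<d }

  single-at : ∀ {m} (i : Fin m) x → single i x i ≡ x
  single-at zero    x = refl
  single-at (suc i) x = single-at i x

  single-off : ∀ {m} (i k : Fin m) x → i ≢ k → single i x k ≡ 0
  single-off zero    zero    x i≢k = contradiction refl i≢k
  single-off zero    (suc k) x _   = refl
  single-off (suc i) zero    x _   = refl
  single-off (suc i) (suc k) x i≢k = single-off i k x (i≢k ∘ cong suc)

  sum≡1⇒∃ : ∀ {m} (a : Fin m → ℕ) → sum a ≡ 1 → ∃ λ j → a j ≡ 1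
  sum≡1⇒∃ {suc m} a eq with a zero in eq₀
  ... | zero        = let (j , aj) = sum≡1⇒∃ (a ∘ suc) eq in suc j , aj
  ... | suc zero    = zero , eq₀

  -- `Almost j` allows part j to be {0}: this happens after division by d when A_j is exactly
  -- {0,...,d-1}.
  Marked Almost : ∀ {m N} → Fin (suc m) → Vec (Subset N) (suc m) → Set
  Marked j A = Proper A × ⟦ A ⟧ j 1
  Almost {N = N} j A = SumSystem N ⟦ A ⟧ × (∀ i → HasPositive (lookup A (punchIn j i)))

  -- A positive element of the first part gives 1 < N, and in a representation of 1 some summand
  -- equals 1.
  Proper⇒∃Marked : ∀ {m N} (A : Vec (Subset N) (suc m)) → Proper A → ∃ λ j → Marked j A
  Proper⇒∃Marked {N = N} A proper@(sys , pos)
    with SumSystem.covers sys 1 (≤-trans (s≤s (s≤s z≤n)) (mem-< (lookup A zero) (proj₂ (pos zero))))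
  ... | a , a∈ , eq with sum≡1⇒∃ a eq
  ...   | j , aj≡1 = j , proper , subst (⟦ A ⟧ j) aj≡1 (a∈ j)

  -- Otherwise 1 would have two representations, with the summand 1 at i and at j.
  Marked-unique : ∀ {m N} (A : Vec (Subset N) (suc m)) → 1 ≤ N → ∀ i j → i ≢ j → Marked i A → ¬ Marked j A
  Marked-unique A 1≤N i j i≢j ((sys , _) , 1∈i) (_ , 1∈j) = contradiction
    (trans (sym (single-at i 1)) (trans (SumSystem.unique sys (single i 1) (single j 1)
      (Member-single ⟦ A ⟧ 0∈ i 1 1∈i) (Member-single ⟦ A ⟧ 0∈ j 1 1∈j)
      (trans (sum-single i 1) (sym (sum-single j 1))) i) (single-off j i 1 (i≢j ∘ sym))))
    λ ()
    where
    0∈ = 0∈parts 1≤N sys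

  Almost∧marked⇒Marked : ∀ {m N} j (A : Vec (Subset N) (suc m)) → Almost j A × ⟦ A ⟧ j 1 → Marked j A
  Almost∧marked⇒Marked j A ((sys , pos) , 1∈) = (sys , punchIn-elim (λ i → HasPositive (lookup A i)) j (0 , 1∈) pos) , 1∈

  Marked⇒Almost∧marked : ∀ {m N} j (A : Vec (Subset N) (suc m)) → Marked j A → Almost j A × ⟦ A ⟧ j 1
  Marked⇒Almost∧marked j A ((sys , pos) , 1∈) = (sys , pos ∘ punchIn j) , 1∈

  ⟪0⟫ : ∀ N → Subset N
  ⟪0⟫ N = select N (ℕ._≟ 0)

  module _ {m N : ℕ} (j : Fin (suc m)) where

    insert⟪0⟫ : Vec (Subset N) m → Vec (Subset N) (suc m)
    insert⟪0⟫ A = Vec.insertAt A j (⟪0⟫ N)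

    insert⟪0⟫-injective : ∀ A B → insert⟪0⟫ A ≡ insert⟪0⟫ B → A ≡ B
    insert⟪0⟫-injective A B eq = lookup-ext λ i → trans (sym (insertAt-punchIn A j (⟪0⟫ N) i))
      (trans (cong (λ C → lookup C (punchIn j i)) eq) (insertAt-punchIn B j (⟪0⟫ N) i))

    insert⟪0⟫-only0 : ∀ A {x} → ⟦ insert⟪0⟫ A ⟧ j x → x ≡ 0
    insert⟪0⟫-only0 A {x} x∈ = select⁻ N (ℕ._≟ 0) (mem-subst (insertAt-lookup A j (⟪0⟫ N)) x∈)

    insert⟪0⟫-0∈ : 1 ≤ N → ∀ A → ⟦ insert⟪0⟫ A ⟧ j 0
    insert⟪0⟫-0∈ 1≤N A = mem-subst (sym (insertAt-lookup A j (⟪0⟫ N))) (select⁺ N (ℕ._≟ 0) 1≤N refl)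

    Proper⇒Almost-insert⟪0⟫ : 1 ≤ N → ∀ A → Proper A → Almost j (insert⟪0⟫ A)
    Proper⇒Almost-insert⟪0⟫ 1≤N A (sys , pos) =
      insertTrivial j (insert⟪0⟫-0∈ 1≤N A) (insert⟪0⟫-only0 A)
        (SumSystem-resp (λ i x → mem-subst (sym (other i))) (λ i x → mem-subst (other i)) sys) ,
      λ i → subst HasPositive (sym (other i)) (pos i)
      where
      other : ∀ i → lookup (insert⟪0⟫ A) (punchIn j i) ≡ lookup A i
      other = insertAt-punchIn A j (⟪0⟫ N)

    -- These are the two summands of `almostCount`: a part {0} at j can be deleted, which leaves a
    -- proper system of m parts.
    AlmostCases : Vec (Subset N) (suc m) → Set
    AlmostCases A = Proper A ⊎ (∃ λ B → Proper B × insert⟪0⟫ B ≡ A)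

    AlmostCases⇒Almost : 1 ≤ N → ∀ A → AlmostCases A → Almost j A
    AlmostCases⇒Almost 1≤N A (inj₁ (sys , pos))           = sys , pos ∘ punchIn j
    AlmostCases⇒Almost 1≤N A (inj₂ (B , proper , refl)) = Proper⇒Almost-insert⟪0⟫ 1≤N B proper

    AlmostCases-disjoint : ∀ A → Proper A → ¬ (∃ λ B → Proper B × insert⟪0⟫ B ≡ A)
    AlmostCases-disjoint A (_ , pos) (B , _ , refl) with insert⟪0⟫-only0 B (proj₂ (pos j))
    ... | ()

    Almost⇒AlmostCases : 1 ≤ N → ∀ A → Almost j A → AlmostCases A
    Almost⇒AlmostCases 1≤N A (sys , pos) with HasPositive? (lookup A j) (0∈parts 1≤N sys j)
    ... | yes p = inj₁ (sys , punchIn-elim (λ i → HasPositive (lookup A i)) j p pos)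
    ... | no ¬p = inj₂ (B ,
        (SumSystem-resp (λ i x → mem-subst (sym (other i))) (λ i x → mem-subst (other i))
          (removeTrivial j (0∈parts 1≤N sys j) only0 sys) ,
         λ i → subst HasPositive (sym (other i)) (pos i)) ,
        lookup-ext (punchIn-elim (λ i → lookup (insert⟪0⟫ B) i ≡ lookup A i) j
          (trans (insertAt-lookup B j (⟪0⟫ N)) trivial)
          (λ i → trans (insertAt-punchIn B j (⟪0⟫ N) i) (other i))))
      where
      B : Vec (Subset N) m
      B = tabulate (lookup A ∘ punchIn j)
      other : ∀ i → lookup B i ≡ lookup A (punchIn j i)
      other = lookup∘tabulate (lookup A ∘ punchIn j)
      only0 : ∀ {x} → ⟦ A ⟧ j x → x ≡ 0
      only0 {zero}  _  = refl
      only0 {suc x} x∈ = contradiction (x , x∈) ¬p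
      trivial : ⟪0⟫ N ≡ lookup A j
      trivial = mem-ext
        (λ x x∈ → subst (⟦ A ⟧ j) (sym (select⁻ N (ℕ._≟ 0) x∈)) (0∈parts 1≤N sys j))
        (λ x x∈ → select⁺ N (ℕ._≟ 0) (mem-< (lookup A j) x∈) (only0 x∈))

  -- Decomposition of marked systems by the least missing integer.

  selectAll : ∀ N {m} {s : Family m} → (∀ i x → Dec (s i x)) → Vec (Subset N) m
  selectAll N s? = tabulate (λ i → select N (s? i))

  selectAll⁺ : ∀ N {m} {s : Family m} (s? : ∀ i x → Dec (s i x)) {i x} → x < N → s i x → ⟦ selectAll N s? ⟧ i x
  selectAll⁺ N s? {i} {x} x<N x∈ = mem-subst (sym (lookup∘tabulate _ i)) (select⁺ N (s? i) x<N x∈)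

  selectAll⁻ : ∀ N {m} {s : Family m} (s? : ∀ i x → Dec (s i x)) {i x} → ⟦ selectAll N s? ⟧ i x → s i x
  selectAll⁻ N s? {i} {x} x∈ = select⁻ N (s? i) (mem-subst (lookup∘tabulate _ i) x∈)

  inflate? : ∀ {m N} (j : Fin m) d .{{_ : NonZero d}} (A : Vec (Subset N) m) i x → Dec (inflate j d ⟦ A ⟧ i x)
  inflate? j d A i x = ⟦⟧? A i (x / d) ×-dec (¬? (i Fin.≟ j) →-dec (d ∣? x))

  -- The range M is a separate parameter because the source range will be M / d, and M = (M / d) d
  -- holds only as a proved equation.
  stretch : ∀ {m N} M (j : Fin m) d .{{_ : NonZero d}} → Vec (Subset N) m → Vec (Subset M) m
  stretch M j d A = selectAll M (inflate? j d A)

  module Stretch {m N M : ℕ} (j : Fin (suc m)) (d : ℕ) .{{_ : NonZero d}} (M≡ : M ≡ N * d) where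

    module _ (A : Vec (Subset N) (suc m)) where

      stretch⁺ : ∀ {i x} → inflate j d ⟦ A ⟧ i x → ⟦ stretch M j d A ⟧ i x
      stretch⁺ {i} {x} x∈ = selectAll⁺ M (inflate? j d A) x<M x∈
        where
        x<M : x < M
        x<M = subst (x <_) (sym M≡) (ℕₚ.<-≤-trans
          (subst (_< suc (x / d) * d) (sym (m≡m%n+[m/n]*n x d)) (ℕₚ.+-monoˡ-< (x / d * d) (m%n<n x d)))
          (ℕₚ.*-monoˡ-≤ d (mem-< (lookup A i) (proj₁ x∈))))

      stretch⁻ : ∀ {i x} → ⟦ stretch M j d A ⟧ i x → inflate j d ⟦ A ⟧ i x
      stretch⁻ = selectAll⁻ M (inflate? j d A)

      stretch-multiple : ∀ {i x} → ⟦ A ⟧ i x → ⟦ stretch M j d A ⟧ i (x * d)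
      stretch-multiple {i} {x} x∈ = stretch⁺ (subst (⟦ A ⟧ i) (sym (m*n/n≡m x d)) x∈ , λ _ → n∣m*n x)

      stretch-Marked : 2 ≤ d → 1 ≤ N → Almost j A → Marked j (stretch M j d A)
      stretch-Marked 2≤d 1≤N (sys , pos) = Almost∧marked⇒Marked j (stretch M j d A)
        ((SumSystem-resp (λ i x → stretch⁺ {i} {x}) (λ i x → stretch⁻ {i} {x})
            (subst (λ K → SumSystem K (inflate j d ⟦ A ⟧)) (sym M≡) (inflate-SumSystem d j sys)) ,
          λ i → positive i (pos i)) , 1∈)
        where
        positive : ∀ i → HasPositive (lookup A (punchIn j i)) → HasPositive (lookup (stretch M j d A) (punchIn j i))
        -- The witness is the predecessor of (x + 1) d.
        positive i (x , x∈) = x * d ℕ.+ ℕ.pred d , subst (⟦ stretch M j d A ⟧ (punchIn j i))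
          (trans (ℕₚ.+-comm d (x * d)) (trans (cong (_+_ (x * d)) (sym (ℕₚ.suc-pred d))) (ℕₚ.+-suc (x * d) (ℕ.pred d))))
          (stretch-multiple x∈)
        1∈ : ⟦ stretch M j d A ⟧ j 1
        1∈ = stretch⁺ (subst (⟦ A ⟧ j) (sym (m<n⇒m/n≡0 2≤d)) (0∈parts 1≤N sys j) , λ j≢j → contradiction refl j≢j)

    -- The multiples of d in each stretched part determine the original part.
    stretch-injective : ∀ A B → stretch M j d A ≡ stretch M j d B → A ≡ B
    stretch-injective A B eq = ⟦⟧-ext (λ i x → half A B eq) (λ i x → half B A (sym eq))
      where
      half : ∀ A B → stretch M j d A ≡ stretch M j d B → ∀ {i x} → ⟦ A ⟧ i x → ⟦ B ⟧ i x
      half A B eq {i} {x} x∈ = subst (⟦ B ⟧ i) (m*n/n≡m x d)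
        (proj₁ (stretch⁻ B (subst (λ C → ⟦ C ⟧ i (x * d)) eq (stretch-multiple A x∈))))

  -- After stretching by d, the condition 1 ∉ A_j becomes the absence of d from part j, so that d is
  -- its least missing integer.
  Unmarked : ∀ {m N} → Fin (suc m) → Vec (Subset N) (suc m) → Set
  Unmarked j A = Almost j A × ¬ ⟦ A ⟧ j 1

  -- The index k stands for the divisor d = k + 1, as in `⋆-term`, and `1 ≤ k` excludes d = 1, just
  -- as the factor 1 - e does.
  Piece : ∀ {m N} → Fin (suc m) → ℕ → Vec (Subset N) (suc m) → Set
  Piece {m} {N} j k A = 1 ≤ k × suc k ∣ N ×
    (∃ λ (B : Vec (Subset (N / suc k)) (suc m)) → Unmarked j B × stretch N j (suc k) B ≡ A)

  Piece⇒Marked : ∀ {m N} → 1 ≤ N → ∀ j k (A : Vec (Subset N) (suc m)) → Piece j k A → Marked j A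
  Piece⇒Marked 1≤N j k _ (1≤k , dv , B , (almost , _) , refl) =
    Stretch.stretch-Marked j (suc k) (sym (m/n*n≡m dv)) B (s≤s 1≤k) (/≥1 k 1≤N dv) almost

  -- The least positive integer outside A_j distinguishes the pieces.
  Piece-disjoint : ∀ {m N} → 1 ≤ N → ∀ j k l (A : Vec (Subset N) (suc m)) → k < l → Piece j k A → ¬ Piece j l A
  Piece-disjoint 1≤N j k l _ k<l (_ , dk , B , (_ , 1∉) , refl) (_ , dl , C , ((sys , _) , _) , eq) =
    1∉ (subst (⟦ B ⟧ j) (n/n≡1 (suc k)) (proj₁ (Stretch.stretch⁻ j (suc k) (sym (m/n*n≡m dk)) B
      (subst (λ D → ⟦ D ⟧ j (suc k)) eq (Stretch.stretch⁺ j (suc l) (sym (m/n*n≡m dl)) C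
        (subst (⟦ C ⟧ j) (sym (m<n⇒m/n≡0 (s≤s k<l))) (0∈parts (/≥1 l 1≤N dl) sys j) , λ j≢j → contradiction refl j≢j))))))

  -- The least integer d missing from A_j is at most N, because N itself is missing, and exceeds 1,
  -- because 0 and 1 are present. The dichotomy makes the quotient B by d a sum system, and d ∉ A_j
  -- becomes 1 ∉ B_j.
  Marked⇒Piece : ∀ {m N} → 1 ≤ N → ∀ j (A : Vec (Subset N) (suc m)) → Marked j A → ∃ λ k → k < N × Piece j k A
  Marked⇒Piece {m} {N} 1≤N j A ((sys , pos) , 1∈)
    with least-failure (⟦⟧? A j) N (λ N∈ → ℕₚ.<-irrefl refl (mem-< (lookup A j) N∈))
  ... | zero , _ , 0∉ , _ = contradiction (0∈parts 1≤N sys j) 0∉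
  ... | suc zero , _ , 1∉ , _ = contradiction 1∈ 1∉
  ... | suc k@(suc _) , k<N , d∉ , initial =
    k , k<N , s≤s z≤n , d∣N , B , ((B-system , B-positive) , 1∉B) , ⟦⟧-ext (λ i x → to) (λ i x → from)
    where
    open Split.Leading {s = ⟦ A ⟧} 1≤N sys j k initial d∉
    d N′ : ℕ
    d = suc k
    N′ = N / d
    N≡ : N ≡ N′ * d
    N≡ = sym (m/n*n≡m d∣N)
    deflate? : ∀ i x → Dec (deflate d ⟦ A ⟧ i x)
    deflate? i x = ⟦⟧? A i (x * d)
    B : Vec (Subset N′) (suc m)
    B = selectAll N′ deflate?
    B⁺ : ∀ {i x} → ⟦ A ⟧ i (x * d) → ⟦ B ⟧ i x
    B⁺ {i} {x} x∈ = selectAll⁺ N′ deflate?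
      (ℕₚ.*-cancelʳ-< d x N′ (subst (x * d <_) N≡ (mem-< (lookup A i) x∈))) x∈
    B⁻ : ∀ {i x} → ⟦ B ⟧ i x → ⟦ A ⟧ i (x * d)
    B⁻ = selectAll⁻ N′ deflate?
    B-system : SumSystem N′ ⟦ B ⟧
    B-system = SumSystem-resp (λ i x → B⁺) (λ i x → B⁻)
      (deflate-SumSystem d j d∣others A⇒floor (subst (λ K → SumSystem K ⟦ A ⟧) N≡ sys))
    B-positive : ∀ i → HasPositive (lookup B (punchIn j i))
    B-positive i with pos (punchIn j i)
    ... | x , x∈ with d∣others i x∈
    ...   | divides (suc q) eq = q , B⁺ (subst (⟦ A ⟧ (punchIn j i)) eq x∈)
    1∉B : ¬ ⟦ B ⟧ j 1
    1∉B 1∈B = d∉ (subst (⟦ A ⟧ j) (ℕₚ.*-identityˡ d) (B⁻ {j} {1} 1∈B))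
    to : ∀ {i x} → ⟦ stretch N j d B ⟧ i x → ⟦ A ⟧ i x
    to {i} {x} x∈ with Stretch.stretch⁻ j d N≡ B {i} {x} x∈ | i Fin.≟ j
    ... | q∈ , _  | yes refl = floor⇒A (B⁻ q∈)
    ... | q∈ , dv | no i≢j   = subst (⟦ A ⟧ i) (m/n*n≡m (dv i≢j)) (B⁻ q∈)
    from : ∀ {i x} → ⟦ A ⟧ i x → ⟦ stretch N j d B ⟧ i x
    from {i} {x} = punchIn-elim (λ i → ∀ {x} → ⟦ A ⟧ i x → ⟦ stretch N j d B ⟧ i x) j
      (λ {x} x∈ → Stretch.stretch⁺ j d N≡ B {j} {x} (B⁺ (A⇒floor x∈) , λ j≢j → contradiction refl j≢j))
      (λ i {x} x∈ → Stretch.stretch⁺ j d N≡ B {punchIn j i} {x}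
        (B⁺ (subst (⟦ A ⟧ (punchIn j i)) (sym (m/n*n≡m (d∣others i x∈))) x∈) , λ _ → d∣others i x∈)) i

-- Cardinalities of predicates as integers.

open DirichletAlgebra
open SumSystems
open Equivalence using (to; from)
open import Data.Integer using (+_; _*_)
open import Data.Integer using (_+_; _-_)

-- The value is an integer because the recursion subtracts and μ takes negative values; the witness
-- k certifies that it is a cardinality.
Counts : {A : Set} → (A → Set) → ℤ → Set
Counts P z = ∃ λ k → NumberOf P k × + k ≡ z

module _ {A : Set} where

  counts-⇔ : ∀ {P Q : A → Set} {z} → (∀ x → P x → Q x) → (∀ x → Q x → P x) → Counts P z → Counts Q z
  counts-⇔ f g (k , (xs , xs! , len , ∈⇔) , eq) =
    k , (xs , xs! , len , λ x → mk⇔ (f x ∘ to (∈⇔ x)) (from (∈⇔ x) ∘ g x)) , eq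

  counts-∅ : ∀ {P : A → Set} → (∀ x → ¬ P x) → Counts P 0ℤ
  counts-∅ ¬P = 0 , ([] , [] , refl , λ x → mk⇔ (λ ()) (λ p → contradiction p (¬P x))) , refl

  counts-⊎ : ∀ {P Q : A → Set} {y z} → (∀ x → P x → ¬ Q x) → Counts P y → Counts Q z →
    Counts (λ x → P x ⊎ Q x) (y + z)
  counts-⊎ disjoint (k , (xs , xs! , refl , x∈⇔) , refl) (l , (ys , ys! , refl , y∈⇔) , refl) =
    k ℕ.+ l ,
    (xs ++ ys , Unique.++⁺ xs! ys! (λ (x∈ , y∈) → disjoint _ (to (x∈⇔ _) x∈) (to (y∈⇔ _) y∈)) , length-++ xs ,
     λ x → mk⇔ ([ inj₁ ∘ to (x∈⇔ x) , inj₂ ∘ to (y∈⇔ x) ]′ ∘ ∈-++⁻ xs)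
               [ ∈-++⁺ˡ ∘ from (x∈⇔ x) , ∈-++⁺ʳ xs ∘ from (y∈⇔ x) ]′) ,
    ℤₚ.pos-+ k l

  counts-image : ∀ {B : Set} (f : A → B) → (∀ x y → f x ≡ f y → x ≡ y) → ∀ {P : A → Set} {z} → Counts P z →
    Counts (λ b → ∃ λ a → P a × f a ≡ b) z
  counts-image f inj (k , (xs , xs! , len , ∈⇔) , eq) =
    k ,
    (List.map f xs , Unique.map⁺ (inj _ _) xs! , trans (length-map f xs) len ,
     λ b → mk⇔ (λ b∈ → let (a , a∈ , b≡fa) = ∈-map⁻ f b∈ in a , to (∈⇔ a) a∈ , sym b≡fa)
               (λ { (a , p , refl) → ∈-map⁺ f (from (∈⇔ a) p) })) ,
    eq

  counts-∃< : ∀ (P : ℕ → A → Set) f K → (∀ k → k < K → Counts (P k) (f k)) →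
    (∀ k l x → k < l → P k x → ¬ P l x) → Counts (λ x → ∃ λ k → k < K × P k x) (sumBelow f K)
  counts-∃< P f zero    _      _        = counts-∅ λ { x (k , () , _) }
  counts-∃< P f (suc K) counts disjoint = counts-⇔
    (λ x → [ (λ (k , k<K , p) → k , ℕₚ.m<n⇒m<1+n k<K , p) , (λ p → K , ≤-refl , p) ]′)
    (λ x (k , k<1+K , p) → split x k k<1+K p)
    (counts-⊎ (λ x (k , k<K , p) q → disjoint k K x k<K p q)
      (counts-∃< P f K (λ k k<K → counts k (ℕₚ.m<n⇒m<1+n k<K)) disjoint)
      (counts K ≤-refl))
    where
    split : ∀ x k → k < suc K → P k x → (∃ λ k → k < K × P k x) ⊎ P K x
    split x k k<1+K p with k ℕ.≟ K
    ... | yes refl = inj₂ p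
    ... | no k≢K   = inj₁ (k , ℕₚ.≤∧≢⇒< (ℕₚ.≤-pred k<1+K) k≢K , p)

  counts-∃Fin : ∀ {m} (P : Fin m → A → Set) {z} → (∀ i → Counts (P i) z) →
    (∀ i j x → i ≢ j → P i x → ¬ P j x) → Counts (λ x → ∃ λ i → P i x) (+ m * z)
  counts-∃Fin {zero}  P     counts disjoint = counts-∅ λ { x (() , _) }
  counts-∃Fin {suc m} P {z} counts disjoint = subst (Counts _) (sym (ℤₚ.suc-* (+ m) z)) (counts-⇔
    (λ x → [ (λ p → zero , p) , (λ (i , p) → suc i , p) ]′)
    (λ { x (zero , p) → inj₁ p ; x (suc i , p) → inj₂ (i , p) })
    (counts-⊎ (λ x p (i , q) → disjoint zero (suc i) x (λ ()) p q)
      (counts zero)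
      (counts-∃Fin (P ∘ suc) (counts ∘ suc) (λ i j x i≢j → disjoint (suc i) (suc j) x (λ { refl → i≢j refl })))))

  length-filter-complement : ∀ {Q : A → Set} (Q? : ∀ x → Dec (Q x)) xs →
    length (filter (¬? ∘ Q?) xs) ℕ.+ length (filter Q? xs) ≡ length xs
  length-filter-complement Q? []       = refl
  length-filter-complement Q? (x ∷ xs) with Q? x
  ... | yes _ = trans (ℕₚ.+-suc _ _) (cong suc (length-filter-complement Q? xs))
  ... | no _  = cong suc (length-filter-complement Q? xs)

  -- Filtering an enumeration of P by Q splits it in two; the half satisfying Q has the same entries
  -- as the enumeration of P and Q, hence the same length.
  counts-∖ : ∀ {P Q : A → Set} {y z} → (∀ x → Dec (Q x)) → Counts P y → Counts (λ x → P x × Q x) z →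
    Counts (λ x → P x × ¬ Q x) (y - z)
  counts-∖ Q? (k , (xs , xs! , refl , x∈⇔) , refl) (l , (ys , ys! , refl , y∈⇔) , refl) =
    length (filter (¬? ∘ Q?) xs) ,
    (filter (¬? ∘ Q?) xs , Unique.filter⁺ (¬? ∘ Q?) xs! , refl ,
     λ x → mk⇔ (λ x∈ → let (x∈xs , ¬q) = ∈-filter⁻ (¬? ∘ Q?) x∈ in to (x∈⇔ x) x∈xs , ¬q)
               (λ (p , ¬q) → ∈-filter⁺ (¬? ∘ Q?) (from (x∈⇔ x) p) ¬q)) ,
    difference
    where
    same : length (filter Q? xs) ≡ length ys
    same = unique-⇔⇒length≡ (Unique.filter⁺ Q? xs!) ys!
      (λ {x} x∈ → let (x∈xs , q) = ∈-filter⁻ Q? x∈ in from (y∈⇔ x) (to (x∈⇔ x) x∈xs , q))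
      (λ {x} x∈ → let (p , q) = to (y∈⇔ x) x∈ in ∈-filter⁺ Q? (from (x∈⇔ x) p) q)
    n : ℕ
    n = length (filter (¬? ∘ Q?) xs)
    difference : + n ≡ + length xs - + length ys
    difference = begin
      + n                                        ≡⟨ cancel (+ n) (+ length ys) ⟩
      (+ n + + length ys) - + length ys          ≡⟨ cong (_- + length ys) (ℤₚ.pos-+ n (length ys)) ⟨
      + (n ℕ.+ length ys) - + length ys          ≡⟨ cong (λ l → + (n ℕ.+ l) - + length ys) same ⟨
      + (n ℕ.+ length (filter Q? xs)) - + length ys ≡⟨ cong (λ l → + l - + length ys) (length-filter-complement Q? xs) ⟩
      + length xs - + length ys                  ∎
      where
      open ≡-Reasoning
      cancel : ∀ a b → a ≡ (a + b) - b
      cancel = solve-∀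

-- Strong induction on N.

SystemCounts : ℕ → Set
SystemCounts N = 1 ≤ N →
  (∀ m → Counts (Proper {m} {N}) (systemCount m N)) × (∀ m j → Counts (Marked {m} {N} j) (markedCount m N))

module Step (N : ℕ) (1≤N : 1 ≤ N) (smaller : ∀ {n} → n < N → SystemCounts n) where

  almost : ∀ n → n < N → 1 ≤ n → ∀ m j → Counts (Almost {m} {n} j) (almostCount m n)
  almost n n<N 1≤n m j = counts-⇔ (AlmostCases⇒Almost j 1≤n) (Almost⇒AlmostCases j 1≤n)
    (counts-⊎ (AlmostCases-disjoint j) (proj₁ (smaller n<N 1≤n) (suc m))
      (counts-image (insert⟪0⟫ j) (insert⟪0⟫-injective j) (proj₁ (smaller n<N 1≤n) m)))

  unmarked : ∀ n → n < N → 1 ≤ n → ∀ m j → Counts (Unmarked {m} {n} j) ((almostCount m ⊖ markedCount m) n)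
  unmarked n n<N 1≤n m j = counts-∖ (λ A → ⟦⟧? A j 1) (almost n n<N 1≤n m j)
    (counts-⇔ (Marked⇒Almost∧marked j) (Almost∧marked⇒Marked j) (proj₂ (smaller n<N 1≤n) m j))

  -- The pieces match the terms of the convolution one by one: the factor 1 - e is 0 at the divisor
  -- 1 and 1 at every larger divisor.
  piece : ∀ m j k → Counts (Piece {m} {N} j k) (⋆-term (one ⊖ e) (almostCount m ⊖ markedCount m) N k)
  piece m j zero = subst (Counts _) (sym (when-0 (1 ∣? N))) (counts-∅ λ { A (() , _) })
  piece m j k@(suc _) with suc k ∣? N
  ... | no ¬d = subst (Counts _) (sym (when-no (suc k ∣? N) _ ¬d)) (counts-∅ λ A (_ , dv , _) → ¬d dv)
  ... | yes dv = subst (Counts _) (sym (trans (when-yes (suc k ∣? N) _ dv) (ℤₚ.*-identityˡ _)))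
    (counts-⇔ (λ A image → s≤s z≤n , dv , image) (λ A (_ , _ , image) → image)
      (counts-image (stretch N j (suc k)) (Stretch.stretch-injective j (suc k) (sym (m/n*n≡m dv)))
        (unmarked (N / suc k) (m/n<m N (suc k) {{ℕ.>-nonZero 1≤N}} (s≤s (s≤s z≤n))) (/≥1 k 1≤N dv) m j)))

  -- Summing the pieces gives the right-hand side of `ε⋆-recursion` at N, which is the closed form
  -- of the marked count.
  marked : ∀ m j → Counts (Marked {m} {N} j) (markedCount m N)
  marked m j = subst (Counts (Marked j))
    (trans (sym (⋆-as-sumBelow (one ⊖ e) (almostCount m ⊖ markedCount m) N)) (sym (ε⋆-recursion (almostCount m) N 1≤N)))
    (counts-⇔ (λ A (k , _ , p) → Piece⇒Marked 1≤N j k A p) (Marked⇒Piece 1≤N j)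
      (counts-∃< (Piece j) _ N (λ k _ → piece m j k) (Piece-disjoint 1≤N j)))

  proper : ∀ m → Counts (Proper {m} {N}) (systemCount m N)
  proper zero = subst (Counts Proper) (sym (systemCount-zero N 1≤N)) (base N 1≤N)
    where
    -- Without parts the only sum is the empty sum 0, so a system exists for N = 1 alone.
    base : ∀ N → 1 ≤ N → Counts (Proper {0} {N}) (e N)
    base (suc zero)    _ = 1 , ([] ∷ [] , [] ∷ [] , refl , λ { [] → mk⇔ (λ _ → trivial , λ ()) (λ _ → here refl) }) , refl
      where
      trivial : SumSystem 1 (⟦_⟧ {1} {0} [])
      trivial = record
        { bounded = λ _ _ → s≤s z≤n
        ; covers  = λ { zero _ → (λ ()) , (λ ()) , refl ; (suc n) (s≤s ()) }
        ; unique  = λ _ _ _ _ _ ()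
        }
    base (suc (suc N)) _ = counts-∅ empty
      where
      empty : ∀ A → ¬ Proper {0} {suc (suc N)} A
      empty A (sys , _) with SumSystem.covers sys 1 (s≤s (s≤s z≤n))
      ... | _ , _ , ()
  proper (suc m) = subst (Counts Proper) (sym (systemCount-suc m N 1≤N))
    (counts-⇔ (λ A (j , p , _) → p) Proper⇒∃Marked
      (counts-∃Fin Marked (marked m) (λ i j A → Marked-unique A 1≤N i j)))

-- Both counts are carried for all m at once, because a marked system at N reduces to unmarked ones
-- at N/d, whose number involves P_{m+1}, P_m and the marked count there.
systemCounts : ∀ N → SystemCounts N
systemCounts = <-rec SystemCounts (λ N smaller 1≤N → Step.proper N 1≤N smaller , Step.marked N 1≤N smaller)

theorem3p2 : (m N : ℕ) → 1 ≤ m → 1 ≤ N →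
    ∃ λ (k : ℕ) → NumberOf (IsProperSumSystem m N) k
    × FiniteSeriesSum (λ L → + (m ! Data.Nat.* S L m) * ((e ⊖ μ) ^⋆ L) N) (+ k)
    × FiniteSeriesSum (λ L → + (m ! Data.Nat.* S L m) * c L N) (+ k)
theorem3p2 m N _ 1≤N = let (k , number , eq) = count in k , number ,
  -- Both series may be cut at N, since every term with L ≥ N vanishes.
  (N , vanish , sym eq) ,
  (N , (λ L N≤L → trans (same L) (vanish L N≤L)) , trans (sumBelow-cong N (λ L _ → same L)) (sym eq))
  where
  count : Counts (IsProperSumSystem m N) (systemCount m N)
  count = counts-⇔ (λ A → from (IsProperSumSystem⇔Proper 1≤N A)) (λ A → to (IsProperSumSystem⇔Proper 1≤N A))
    (proj₁ (systemCounts N 1≤N) m)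
  vanish : ∀ L → N ≤ L → surjections L m * (ε ^⋆ L) N ≡ 0ℤ
  vanish L N≤L = trans (cong (_*_ (surjections L m)) (ε-power-vanishes L N 1≤N N≤L)) (ℤₚ.*-zeroʳ (surjections L m))
  same : ∀ L → surjections L m * c L N ≡ surjections L m * (ε ^⋆ L) N
  same L = cong (_*_ (surjections L m)) (c-as-power L N 1≤N)
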